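{- (i) Let $S\equiv\pm\{1, 3, 5, 7, 8, 26, 28, 29, 30, 31, 33, 35\}\pmod{72}$ and $T\equiv\pm\{1, 2, 5, 7, 13, 23, 28, 29, 31, 32, 34, 35\}\pmod{72}$. Then $p(S,n)=p(T,n-1)$ for all $n\geq 1$. (ii) Let $S\equiv\pm\{1, 4, 5, 6, 11, 14, 15, 21, 25, 31, 32, 35\}\pmod{72}$ and $T\equiv\pm\{1, 4, 5, 7, 10, 11, 16, 25, 26, 29, 31, 35\}\pmod{72}$. Then $p(S,n)=p(T,n)$ for all integers $n\ge0$ with $n\neq 6$. (iii) Let $S\equiv\pm\{1, 7, 8, 13, 14, 17, 19, 20, 22, 23, 29, 35\}\pmod{72}$ and $T\equiv\pm\{1, 6, 7, 13, 15, 16, 20, 21, 23, 29, 34, 35\}\pmod{72}$. Then $p(S,n)=p(T,n-1)$ for all $n\geq 1$. (iv) Let $S\equiv\pm\{2, 3, 5, 11, 16, 17, 19, 20, 25, 30, 31, 33\}\pmod{72}$ and $T\equiv\pm\{1, 5, 8, 11, 14, 17, 19, 20, 22, 25, 31, 35\}\pmod{72}$. Then $p(S,n)=p(T,n)$ for all integers $n\ge0$ with $n\neq 1$. (v) Let $S\equiv\pm\{4, 7, 10, 11, 13, 16, 17, 19, 23, 25, 26, 29\}\pmod{72}$ and $T\equiv\pm\{3, 4, 7, 13, 17, 19, 22, 23, 29, 30, 32, 33\}\pmod{72}$. Then $p(S,n)=p(T,n-4)$ for all $n\geq 4$. (vi) Let $S\equiv\pm\{6, 8, 10, 11, 13, 15,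 17, 19, 21, 23, 25, 28\}\pmod{72}$ and $T\equiv\pm\{2, 5, 11, 13, 17, 19, 23, 25, 28, 31, 32, 34\}\pmod{72}$. Then $p(S,n)=p(T,n-6)$ for all $n\geq 6$.
   Context: For a set $S$ of positive integers and an integer $n\ge 0$, $p(S,n)$ denotes the number of partitions of $n$ into parts belonging to $S$ (so $p(S,0)=1$). The notation $S\equiv\pm\{r_1,\dots,r_k\}\pmod M$ means that $S$ is the set of all positive integers $n$ such that $n\equiv r_i$ or $n\equiv -r_i\pmod M$ for some $i$. -}

module Defs where

open import Data.Nat using (ℕ; zero; suc; _+_; _*_; _∸_; _≤ᵇ_; _≡ᵇ_; NonZero)
open import Data.Nat.DivMod using (_%_)
open import Data.Bool using (Bool; true; false; if_then_else_; _∨_)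
open import Data.List using (List)
open import Data.Bool.ListAction using (any)

PartSet : Set
PartSet = ℕ → Bool

-- S ≡ ±{r₁,…,r_k} (mod M): n ∈ S iff n ≡ rᵢ or n ≡ -rᵢ (mod M) for some i.
-- (Only positive n are ever used as parts below.)
pmMod : (M : ℕ) → .{{NonZero M}} → List ℕ → PartSet
pmMod M rs n = any (λ r → ((n % M) ≡ᵇ (r % M)) ∨ ((n % M) ≡ᵇ ((M ∸ (r % M)) % M))) rs

-- pLe S m n = number of partitions of n into parts belonging to S, all parts ≤ m.
-- For the largest allowed part (suc m) we sum over its multiplicity k.
pLe : PartSet → ℕ → ℕ → ℕ
pLe S zero zero = 1
pLe S zero (suc n) = 0
pLe S (suc m) n with S (suc m)
... | false = pLe S m n
... | true = go n
  where
  go : ℕ → ℕ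
  go zero = pLe S m n
  go (suc j) = go j + (if (suc j * suc m) ≤ᵇ n then pLe S m (n ∸ (suc j * suc m)) else 0)

p : PartSet → ℕ → ℕ
p S n = pLe S n n

-- Write [n] and {n} for the products ∏ (1 ∓ q^m) over the positive m ≡ ± n (mod 36).  In all six parts
-- the generating functions of S and T are quotients S₄/C₄ and T₄/C₄ of products of four such factors,
-- with factors {n} in the numerators, factors [n] in C₄, and the same C₄ for S and T; for example in part (i)
--   S₄ = {3}{5}{6}{12},  T₄ = {2}{4}{5}{13},  C₄ = [1][7][8][10].
-- The assertion thus becomes S₄ = q^a T₄ ± q^b C₄, an instance of Weierstrass' three-term relation for
-- theta functions.  By Jacobi's triple product and Ramanujan's formula for the product of two theta functions
-- (a rotation of the index lattice), [m][n] and {m}{n} are sums g₁g₂ ∓ q^m g₃g₄ in theta functions of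
-- base q^72, in terms of which the relation is a polynomial identity.
-- All of this is carried out in a commutative ring with q^M = 0, where sums and products are finite.
module Submission where

open import Algebra using (CommutativeRing; Semiring)
open import Data.Bool using (Bool; true; false; if_then_else_; _∨_)
open import Data.Bool.ListAction using (any)
open import Data.Integer as ℤ using (ℤ; +_; -[1+_]; ∣_∣; 0ℤ; 1ℤ)
import Data.Integer.Properties as ℤₚ
open import Data.List using (List; []; _∷_; _++_; concatMap; length)
open import Data.List.Relation.Binary.Permutation.Propositional as Perm
  using (_↭_; prep; swap; ↭-trans; ↭-sym; ↭-reflexive)
open import Data.List.Relation.Unary.All as All using (All; []; _∷_)
open import Data.Nat as ℕ using (ℕ; zero; suc; z≤n; s≤s; NonZero; _≤ᵇ_; _<ᵇ_; _≡ᵇ_; _%_)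
import Data.Nat.DivMod as DivMod
import Data.Nat.Properties as ℕₚ
open import Data.List.Sort.Base ℕₚ.≤-totalOrder using (module SortingAlgorithm)
open import Data.List.Sort.InsertionSort ℕₚ.≤-decTotalOrder using (sort; insertionSort)
open import Data.Product using (_×_; _,_; ∃)
open import Data.Sum using (_⊎_; inj₁; inj₂)
open import Data.Unit using (tt)
open import Relation.Binary.PropositionalEquality as ≡ using (_≡_; _≢_)
open import Relation.Nullary using (yes; no; contradiction)
open import Relation.Nullary.Decidable using (True; toWitness; _×-dec_)
open import Relation.Unary using (Decidable)
import Algebra.Definitions.RawSemiring as RawSemiringDefinitions
import Algebra.Properties.Ring as RingProperties
import Algebra.Solver.Ring.NaturalCoefficients.Default as NaturalSolver
import Data.Integer.Tactic.RingSolver as ℤ-Solver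
import Data.Nat.Tactic.RingSolver as ℕ-Solver
open import Defs

-- Sums over the integers

-- The polynomial identity behind each part is a Plücker relation. For m < n with m + n < 36 put s =
-- m + n, d = n - m, and let g(k) be the theta function with exponents k and 72 - k. Up to the
-- factor q^(d/2), {m}{n} and [m][n] are the permanent and the determinant of the vectors v(s) and
-- v(d), where v(k) = (g(k), q^(k/2) g(36 - k)). Since {36 - n} = {n} and [36 - n] = [n], the pair
-- (s, d) may be replaced by (36 - d, 36 - s). After such replacements S₄, T₄ and C₄ are the three
-- ways of splitting four indices into two pairs, 18 always being one of the indices, and the
-- relation is per(a,c) per(b,d) - per(b,c) per(a,d) = det(a,b) det(d,c). The factors q^(d/2)
-- account for q^a and q^b. As q is nilpotent in the working ring, only units can be cancelled;
-- products of factors 1 - q^n with n > 0 are units.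

suc-neg : ∀ n → ℤ.suc -[1+ n ] ≡ ℤ.- (+ n)
suc-neg zero = ≡.refl
suc-neg (suc n) = ≡.refl

-c+[c+k]≡k : ∀ c k → ℤ.- c ℤ.+ (c ℤ.+ k) ≡ k
-c+[c+k]≡k = ℤ-Solver.solve-∀

i+[-i+s]≡s : ∀ i s → i ℤ.+ (ℤ.- i ℤ.+ s) ≡ s
i+[-i+s]≡s = ℤ-Solver.solve-∀

∣i∣≤∣i+i∣ : ∀ i → ∣ i ∣ ℕ.≤ ∣ i ℤ.+ i ∣
∣i∣≤∣i+i∣ (+ n)    = ℕₚ.m≤m+n n n
∣i∣≤∣i+i∣ -[1+ n ] = s≤s (ℕₚ.≤-trans (ℕₚ.m≤m+n n n) (ℕₚ.n≤1+n _))

∣i∣≤∣1+i+i∣ : ∀ i → ∣ i ∣ ℕ.≤ ∣ ℤ.suc (i ℤ.+ i) ∣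
∣i∣≤∣1+i+i∣ (+ n)    = ℕₚ.≤-trans (ℕₚ.m≤m+n n n) (ℕₚ.n≤1+n _)
∣i∣≤∣1+i+i∣ -[1+ n ] = s≤s (ℕₚ.m≤m+n n n)

module FiniteSums {r ℓ} (R : CommutativeRing r ℓ) where
  open CommutativeRing R
  open import Relation.Binary.Reasoning.Setoid setoid
  open NaturalSolver commutativeSemiring

  sum± : ℕ → (ℤ → Carrier) → Carrier
  sum± zero    g = g (+ 0)
  sum± (suc n) g = sum± n g + (g (+ suc n) + g -[1+ n ])

  Vanishes : ℕ → (ℤ → Carrier) → Set ℓ
  Vanishes n g = ∀ k → n ℕ.< ∣ k ∣ → g k ≈ 0#

  sum±-cong : ∀ n {g h} → (∀ k → g k ≈ h k) → sum± n g ≈ sum± n h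
  sum±-cong zero    e = e _
  sum±-cong (suc n) e = +-cong (sum±-cong n e) (+-cong (e _) (e _))

  sum±-+ : ∀ n g h → sum± n (λ k → g k + h k) ≈ sum± n g + sum± n h
  sum±-+ zero    g h = refl
  sum±-+ (suc n) g h = trans (+-congʳ (sum±-+ n g h))
    (solve 6 (λ a b c d e f → (a :+ b) :+ ((c :+ d) :+ (e :+ f)) := (a :+ (c :+ e)) :+ (b :+ (d :+ f)))
      refl _ _ _ _ _ _)

  sum±-*ˡ : ∀ n x g → sum± n (λ k → x * g k) ≈ x * sum± n g
  sum±-*ˡ zero    x g = refl
  sum±-*ˡ (suc n) x g = trans (+-congʳ (sum±-*ˡ n x g))
    (solve 4 (λ x a b c → x :* a :+ (x :* b :+ x :* c) := x :* (a :+ (b :+ c))) refl _ _ _ _)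

  sum±-*ʳ : ∀ n x g → sum± n (λ k → g k * x) ≈ sum± n g * x
  sum±-*ʳ n x g = trans (sum±-cong n (λ k → *-comm _ _)) (trans (sum±-*ˡ n x g) (*-comm _ _))

  sum±-zero : ∀ n {g} → (∀ k → g k ≈ 0#) → sum± n g ≈ 0#
  sum±-zero zero    e = e _
  sum±-zero (suc n) e = trans (+-cong (sum±-zero n e) (trans (+-cong (e _) (e _)) (+-identityˡ 0#)))
      (+-identityˡ 0#)

  sum±-swap : ∀ m n (g : ℤ → ℤ → Carrier) →
    sum± m (λ i → sum± n (g i)) ≈ sum± n (λ j → sum± m (λ i → g i j))
  sum±-swap zero    n g = refl
  sum±-swap (suc m) n g = begin
    sum± m (λ i → sum± n (g i)) + (sum± n (g (+ suc m)) + sum± n (g -[1+ m ]))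
      ≈⟨ +-cong (sum±-swap m n g) (sym (sum±-+ n _ _)) ⟩
    sum± n (λ j → sum± m (λ i → g i j)) + sum± n (λ j → g (+ suc m) j + g -[1+ m ] j)
      ≈⟨ sum±-+ n _ _ ⟨
    sum± n (λ j → sum± (suc m) (λ i → g i j)) ∎

  sum±-reflect : ∀ n g → sum± n (λ k → g (ℤ.- k)) ≈ sum± n g
  sum±-reflect zero    g = refl
  sum±-reflect (suc n) g = +-cong (sum±-reflect n g) (+-comm _ _)

  Vanishes-mono : ∀ {m n g} → m ℕ.≤ n → Vanishes m g → Vanishes n g
  Vanishes-mono m≤n v k n<k = v k (ℕₚ.≤-<-trans m≤n n<k)

  sum±-extend : ∀ d {n g} → Vanishes n g → sum± (d ℕ.+ n) g ≈ sum± n g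
  sum±-extend zero    v = refl
  sum±-extend (suc d) {n} v = trans
    (+-cong (sum±-extend d v)
      (trans (+-cong (v _ (s≤s (ℕₚ.m≤n+m n d))) (v _ (s≤s (ℕₚ.m≤n+m n d)))) (+-identityˡ 0#)))
    (+-identityʳ _)

  sum±-bound : ∀ {m n g} → Vanishes m g → Vanishes n g → sum± m g ≈ sum± n g
  sum±-bound {m} {n} {g} v w = trans (sym (sum±-extend n v))
    (trans (reflexive (≡.cong (λ l → sum± l g) (ℕₚ.+-comm n m))) (sum±-extend m w))

  -- Stated with boundary terms because `Vanishes` does not pass to smaller windows: only an exact
  -- identity can be proved by induction on n.
  sum±-suc-boundary : ∀ n g →
    sum± n (λ k → g (ℤ.suc k)) + g (ℤ.- (+ n)) ≈ sum± n g + g (+ suc n)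
  sum±-suc-boundary zero    g = +-comm _ _
  sum±-suc-boundary (suc n) g = begin
    (sum± n (λ k → g (ℤ.suc k)) + (g (+ suc (suc n)) + g (ℤ.suc -[1+ n ]))) + g -[1+ n ]
      ≡⟨ ≡.cong (λ z → (sum± n (λ k → g (ℤ.suc k)) + (g (+ suc (suc n)) + g z)) + g -[1+ n ]) (suc-neg n) ⟩
    (sum± n (λ k → g (ℤ.suc k)) + (g (+ suc (suc n)) + g (ℤ.- (+ n)))) + g -[1+ n ]
      ≈⟨ solve 4 (λ a b c d → (a :+ (b :+ c)) :+ d := ((a :+ c) :+ d) :+ b) refl _ _ _ _ ⟩
    ((sum± n (λ k → g (ℤ.suc k)) + g (ℤ.- (+ n))) + g -[1+ n ]) + g (+ suc (suc n))
      ≈⟨ +-congʳ (+-congʳ (sum±-suc-boundary n g)) ⟩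
    ((sum± n g + g (+ suc n)) + g -[1+ n ]) + g (+ suc (suc n))
      ≈⟨ +-congʳ (+-assoc _ _ _) ⟩
    sum± (suc n) g + g (+ suc (suc n)) ∎

  sum±-suc : ∀ {n g} → Vanishes n g → sum± n g ≈ sum± (suc n) (λ k → g (ℤ.suc k))
  sum±-suc {n} {g} v = begin
    sum± n g
      ≈⟨ sum±-extend 1 v ⟨
    sum± (suc n) g
      ≈⟨ trans (+-congˡ (v _ (s≤s (ℕₚ.n≤1+n n)))) (+-identityʳ _) ⟨
    sum± (suc n) g + g (+ suc (suc n))
      ≈⟨ sum±-suc-boundary (suc n) g ⟨
    sum± (suc n) (λ k → g (ℤ.suc k)) + g -[1+ n ]
      ≈⟨ trans (+-congˡ (v _ ℕₚ.≤-refl)) (+-identityʳ _) ⟩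
    sum± (suc n) (λ k → g (ℤ.suc k)) ∎

  Vanishes-shift : ∀ {n g} c → Vanishes n g → Vanishes (∣ c ∣ ℕ.+ n) (λ k → g (c ℤ.+ k))
  Vanishes-shift {n} {g} c v k lt = v (c ℤ.+ k) (ℕₚ.+-cancelˡ-< ∣ c ∣ n _ (ℕₚ.<-≤-trans lt bound))
    where
    bound : ∣ k ∣ ℕ.≤ ∣ c ∣ ℕ.+ ∣ c ℤ.+ k ∣
    bound = ≡.subst₂ ℕ._≤_ (≡.cong ∣_∣ (-c+[c+k]≡k c k)) (≡.cong (ℕ._+ ∣ c ℤ.+ k ∣) (ℤₚ.∣-i∣≡∣i∣ c))
      (ℤₚ.∣i+j∣≤∣i∣+∣j∣ (ℤ.- c) (c ℤ.+ k))

  sum±-shift⁺ : ∀ c {n g} → Vanishes n g → sum± n g ≈ sum± (c ℕ.+ n) (λ k → g (+ c ℤ.+ k))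
  sum±-shift⁺ zero    {n} {g} v = sum±-cong n (λ k → reflexive (≡.cong g (≡.sym (ℤₚ.+-identityˡ k))))
  sum±-shift⁺ (suc c) {n} {g} v = begin
    sum± n g
      ≈⟨ sum±-shift⁺ c v ⟩
    sum± (c ℕ.+ n) (λ k → g (+ c ℤ.+ k))
      ≈⟨ sum±-suc (Vanishes-shift (+ c) v) ⟩
    sum± (suc c ℕ.+ n) (λ k → g (+ c ℤ.+ ℤ.suc k))
      ≈⟨ sum±-cong (suc c ℕ.+ n) (λ k → reflexive (≡.cong g (lemma k))) ⟩
    sum± (suc c ℕ.+ n) (λ k → g (+ suc c ℤ.+ k)) ∎
    where
    lemma : ∀ k → + c ℤ.+ ℤ.suc k ≡ + suc c ℤ.+ k
    lemma k = ≡.trans (≡.sym (ℤₚ.+-assoc (+ c) 1ℤ k)) (≡.cong (ℤ._+ k) (ℤₚ.+-comm (+ c) 1ℤ))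

  sum±-shift : ∀ c {m n g} → Vanishes m g → Vanishes n (λ k → g (c ℤ.+ k)) →
    sum± m g ≈ sum± n (λ k → g (c ℤ.+ k))
  sum±-shift (+ c)     {m} {n} {g} v w = trans (sum±-shift⁺ c v) (sum±-bound (Vanishes-shift (+ c) v) w)
  -- The shift by `+ suc c` carries the shifted function back to g, so the positive case applies to
  -- it.
  sum±-shift -[1+ c ] {m} {n} {g} v w = sym (trans (sum±-shift⁺ (suc c) w)
    (trans (sum±-cong (suc c ℕ.+ n) (λ k → reflexive (≡.cong g (lemma k)))) (sum±-bound v′ v)))
    where
    lemma : ∀ k → -[1+ c ] ℤ.+ (+ suc c ℤ.+ k) ≡ k
    lemma k = ≡.trans (≡.sym (ℤₚ.+-assoc -[1+ c ] (+ suc c) k))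
      (≡.trans (≡.cong (ℤ._+ k) (ℤₚ.+-inverseˡ (+ suc c))) (ℤₚ.+-identityˡ k))
    v′ : Vanishes (suc c ℕ.+ n) g
    v′ k lt = trans (reflexive (≡.cong g (≡.sym (lemma k)))) (Vanishes-shift (+ suc c) w k lt)

  -- For |k| ≤ n the odd numbers 2k + 1 run from -2n + 1 to 2n + 1, one step beyond the window of
  -- radius 2n; hence the additional term on the left.
  sum±-parity-boundary : ∀ n g →
    sum± (n ℕ.+ n) g + g (+ suc (n ℕ.+ n)) ≈ sum± n (λ k → g (k ℤ.+ k)) + sum± n (λ k → g (ℤ.suc (k ℤ.+ k)))
  sum±-parity-boundary zero    g = refl
  sum±-parity-boundary (suc n) g rewrite ℕₚ.+-suc n n = begin
    ((sum± (n ℕ.+ n) g + (a + b)) + (c + d)) + e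
      ≈⟨ solve 6 (λ s a b c d e → ((s :+ (a :+ b)) :+ (c :+ d)) :+ e := (s :+ a) :+ ((c :+ d) :+ (e :+ b))) refl
          _ _ _ _ _ _ ⟩
    (sum± (n ℕ.+ n) g + a) + ((c + d) + (e + b))
      ≈⟨ +-congʳ (sum±-parity-boundary n g) ⟩
    (sum± n (λ k → g (k ℤ.+ k)) + sum± n (λ k → g (ℤ.suc (k ℤ.+ k)))) + ((c + d) + (e + b))
      ≈⟨ solve 6 (λ s t c d e b → (s :+ t) :+ ((c :+ d) :+ (e :+ b)) := (s :+ (c :+ d)) :+ (t :+ (e :+ b))) refl
          _ _ _ _ _ _ ⟩
    (sum± n (λ k → g (k ℤ.+ k)) + (c + d)) + (sum± n (λ k → g (ℤ.suc (k ℤ.+ k))) + (e + b)) ∎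
    where
    a = g (+ suc (n ℕ.+ n))
    b = g -[1+ n ℕ.+ n ]
    c = g (+ suc (suc (n ℕ.+ n)))
    d = g -[1+ suc (n ℕ.+ n) ]
    e = g (+ suc (suc (suc (n ℕ.+ n))))

  sum±-parity : ∀ {n g} → Vanishes n g →
    sum± n g ≈ sum± n (λ k → g (k ℤ.+ k)) + sum± n (λ k → g (ℤ.suc (k ℤ.+ k)))
  sum±-parity {n} {g} v = begin
    sum± n g
      ≈⟨ sum±-extend n v ⟨
    sum± (n ℕ.+ n) g
      ≈⟨ trans (+-congˡ (v _ (s≤s (ℕₚ.m≤m+n n n)))) (+-identityʳ _) ⟨
    sum± (n ℕ.+ n) g + g (+ suc (n ℕ.+ n))
      ≈⟨ sum±-parity-boundary n g ⟩
    sum± n (λ k → g (k ℤ.+ k)) + sum± n (λ k → g (ℤ.suc (k ℤ.+ k))) ∎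

  Vanishes₂ : ℕ → (ℤ → ℤ → Carrier) → Set ℓ
  Vanishes₂ n g = ∀ i j → n ℕ.< ∣ i ∣ ⊎ n ℕ.< ∣ j ∣ → g i j ≈ 0#

  -- The rotation (i , j) ↦ (i + j , j − i) maps ℤ² onto the pairs of equal parity;
  -- the pairs of opposite parity form its translate.
  sum±-rotate : ∀ n {g} → Vanishes₂ n g → let m = suc (n ℕ.+ n) in
    sum± n (λ i → sum± n (g i)) ≈
    sum± m (λ j → sum± m (λ i → g (j ℤ.+ i) (j ℤ.- i))) +
    sum± m (λ j → sum± m (λ i → g (ℤ.suc (j ℤ.+ i)) (j ℤ.- i)))
  sum±-rotate n {g} v = begin
    sum± n (λ i → sum± n (g i))
      ≈⟨ sum±-cong n (λ i → sum±-shift (ℤ.- i) {n} {m} (λ j lt → v i j (inj₂ lt))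
          (λ s lt → v _ _ (far-even i s lt))) ⟩
    sum± n (λ i → sum± m (λ s → g i (ℤ.- i ℤ.+ s)))
      ≈⟨ sum±-swap n m _ ⟩
    sum± m (λ s → sum± n (λ i → g i (ℤ.- i ℤ.+ s)))
      ≈⟨ sum±-parity (λ s lt → sum±-zero n (λ i → v _ _ (far-even i s lt))) ⟩
    sum± m (λ j → sum± n (λ i → g i (ℤ.- i ℤ.+ (j ℤ.+ j)))) +
    sum± m (λ j → sum± n (λ i → g i (ℤ.- i ℤ.+ ℤ.suc (j ℤ.+ j))))
      ≈⟨ +-cong
        (sum±-cong m (λ j → trans
          (sum±-shift j {n} {m} (λ i lt → v _ _ (inj₁ lt))
            (λ i lt → v _ _ (far (j ℤ.+ i) (ℤ.- (j ℤ.+ i) ℤ.+ (j ℤ.+ j)) i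
                (≡.subst (λ d → ∣ i ∣ ℕ.≤ ∣ d ∣) (even₂ i j) (∣i∣≤∣i+i∣ i)) lt)))
          (sum±-cong m (λ i → reflexive (≡.cong (g (j ℤ.+ i)) (even₁ i j))))))
        (sum±-cong m (λ j → trans
          (sum±-shift (ℤ.suc j) {n} {m} (λ i lt → v _ _ (inj₁ lt))
            (λ i lt → v _ _ (far (ℤ.suc j ℤ.+ i) (ℤ.- (ℤ.suc j ℤ.+ i) ℤ.+ ℤ.suc (j ℤ.+ j)) i
                (≡.subst (λ d → ∣ i ∣ ℕ.≤ ∣ d ∣) (odd₃ i j) (∣i∣≤∣1+i+i∣ i)) lt)))
          (sum±-cong m (λ i → reflexive (≡.cong₂ g (odd₁ i j) (odd₂ i j)))))) ⟩
    sum± m (λ j → sum± m (λ i → g (j ℤ.+ i) (j ℤ.- i))) +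
    sum± m (λ j → sum± m (λ i → g (ℤ.suc (j ℤ.+ i)) (j ℤ.- i))) ∎
    where
    m = suc (n ℕ.+ n)
    even₁ : ∀ i j → ℤ.- (j ℤ.+ i) ℤ.+ (j ℤ.+ j) ≡ j ℤ.- i
    even₁ = ℤ-Solver.solve-∀
    even₂ : ∀ i j → i ℤ.+ i ≡ (j ℤ.+ i) ℤ.- (ℤ.- (j ℤ.+ i) ℤ.+ (j ℤ.+ j))
    even₂ = ℤ-Solver.solve-∀
    odd₁ : ∀ i j → (1ℤ ℤ.+ j) ℤ.+ i ≡ 1ℤ ℤ.+ (j ℤ.+ i)
    odd₁ = ℤ-Solver.solve-∀
    odd₂ : ∀ i j → ℤ.- ((1ℤ ℤ.+ j) ℤ.+ i) ℤ.+ (1ℤ ℤ.+ (j ℤ.+ j)) ≡ j ℤ.- i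
    odd₂ = ℤ-Solver.solve-∀
    odd₃ : ∀ i j → 1ℤ ℤ.+ (i ℤ.+ i) ≡ ((1ℤ ℤ.+ j) ℤ.+ i) ℤ.- (ℤ.- ((1ℤ ℤ.+ j) ℤ.+ i) ℤ.+ (1ℤ ℤ.+ (j ℤ.+ j)))
    odd₃ = ℤ-Solver.solve-∀
    -- The arguments a and b of g differ by 2i or 2i + 1, and |a - b| ≤ 2n if both lie in the window
    -- of radius n. This is why the rotated sums have radius m = 2n + 1.
    far : ∀ a b i → ∣ i ∣ ℕ.≤ ∣ a ℤ.- b ∣ → m ℕ.< ∣ i ∣ → n ℕ.< ∣ a ∣ ⊎ n ℕ.< ∣ b ∣
    far a b i le lt with n ℕ.<? ∣ a ∣ | n ℕ.<? ∣ b ∣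
    ... | yes p | _     = inj₁ p
    ... | no _  | yes q = inj₂ q
    ... | no p  | no q  = contradiction (ℕₚ.≤-trans (ℕₚ.≤-trans le (ℤₚ.∣i-j∣≤∣i∣+∣j∣ a b))
        (ℕₚ.+-mono-≤ (ℕₚ.≮⇒≥ p) (ℕₚ.≮⇒≥ q)))
      (ℕₚ.<⇒≱ (ℕₚ.≤-trans (ℕₚ.n≤1+n _) lt))
    far-even : ∀ i s → m ℕ.< ∣ s ∣ → n ℕ.< ∣ i ∣ ⊎ n ℕ.< ∣ ℤ.- i ℤ.+ s ∣
    far-even i s lt with n ℕ.<? ∣ i ∣ | n ℕ.<? ∣ ℤ.- i ℤ.+ s ∣
    ... | yes p | _     = inj₁ p
    ... | no _  | yes q = inj₂ q
    ... | no p  | no q  = contradiction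
      (ℕₚ.≤-trans (≡.subst (λ t → ∣ t ∣ ℕ.≤ ∣ i ∣ ℕ.+ ∣ ℤ.- i ℤ.+ s ∣) (i+[-i+s]≡s i s)
          (ℤₚ.∣i+j∣≤∣i∣+∣j∣ i (ℤ.- i ℤ.+ s)))
        (ℕₚ.+-mono-≤ (ℕₚ.≮⇒≥ p) (ℕₚ.≮⇒≥ q)))
      (ℕₚ.<⇒≱ (ℕₚ.≤-trans (ℕₚ.n≤1+n _) lt))

-- Theta functions

tri : ℕ → ℕ
tri zero    = 0
tri (suc n) = suc n ℕ.+ tri n

n≤tri : ∀ n → n ℕ.≤ tri n
n≤tri zero    = z≤n
n≤tri (suc n) = ℕₚ.m≤m+n (suc n) (tri n)

triℤ : ℤ → ℕ
triℤ (+ n)    = tri n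
triℤ -[1+ n ] = tri n

tri-double : ∀ n → + tri n ℤ.+ + tri n ≡ + n ℤ.* + n ℤ.+ + n
tri-double zero    = ≡.refl
tri-double (suc n) = ≡.trans (lemma₁ (+ n) (+ tri n))
  (≡.trans (≡.cong (ℤ._+ (+ 2 ℤ.* (1ℤ ℤ.+ + n))) (tri-double n)) (lemma₂ (+ n)))
  where
  lemma₁ : ∀ n t → (1ℤ ℤ.+ n ℤ.+ t) ℤ.+ (1ℤ ℤ.+ n ℤ.+ t) ≡ (t ℤ.+ t) ℤ.+ (+ 2 ℤ.* (1ℤ ℤ.+ n))
  lemma₁ = ℤ-Solver.solve-∀
  lemma₂ : ∀ n → (n ℤ.* n ℤ.+ n) ℤ.+ (+ 2 ℤ.* (1ℤ ℤ.+ n)) ≡ (1ℤ ℤ.+ n) ℤ.* (1ℤ ℤ.+ n) ℤ.+ (1ℤ ℤ.+ n)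
  lemma₂ = ℤ-Solver.solve-∀

triℤ-double : ∀ k → + triℤ k ℤ.+ + triℤ k ≡ k ℤ.* k ℤ.+ k
triℤ-double (+ n)    = tri-double n
triℤ-double -[1+ n ] = ≡.trans (tri-double n) (lemma (+ n))
  where
  lemma : ∀ n → n ℤ.* n ℤ.+ n ≡ ℤ.- (1ℤ ℤ.+ n) ℤ.* ℤ.- (1ℤ ℤ.+ n) ℤ.+ ℤ.- (1ℤ ℤ.+ n)
  lemma = ℤ-Solver.solve-∀

-- The exponent of q in the k-th term a^{k(k+1)/2} b^{k(k−1)/2} of Ramanujan's
-- theta function f(a , b), for a = ± q^A and b = ± q^B.
expo : ℕ → ℕ → ℤ → ℕ
expo A B k = A ℕ.* triℤ k ℕ.+ B ℕ.* triℤ (ℤ.- k)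

-- Doubling removes the halves in k(k ± 1)/2. Identities between exponents thus become polynomial
-- identities over ℤ, and `double-injective` brings them back.
expo-double : ∀ A B k →
  + expo A B k ℤ.+ + expo A B k ≡ + A ℤ.* (k ℤ.* k ℤ.+ k) ℤ.+ + B ℤ.* (k ℤ.* k ℤ.- k)
expo-double A B k = begin
  + expo A B k ℤ.+ + expo A B k
    ≡⟨ ≡.cong₂ (λ x y → (x ℤ.+ y) ℤ.+ (x ℤ.+ y)) (ℤₚ.pos-* A _) (ℤₚ.pos-* B _) ⟩
  (+ A ℤ.* t ℤ.+ + B ℤ.* u) ℤ.+ (+ A ℤ.* t ℤ.+ + B ℤ.* u)
    ≡⟨ lemma₁ (+ A) (+ B) t u ⟩
  + A ℤ.* (t ℤ.+ t) ℤ.+ + B ℤ.* (u ℤ.+ u)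
    ≡⟨ ≡.cong₂ (λ x y → + A ℤ.* x ℤ.+ + B ℤ.* y) (triℤ-double k) (triℤ-double (ℤ.- k)) ⟩
  + A ℤ.* (k ℤ.* k ℤ.+ k) ℤ.+ + B ℤ.* (ℤ.- k ℤ.* ℤ.- k ℤ.+ ℤ.- k)
    ≡⟨ lemma₂ (+ A) (+ B) k ⟩
  + A ℤ.* (k ℤ.* k ℤ.+ k) ℤ.+ + B ℤ.* (k ℤ.* k ℤ.- k) ∎
  where
  open ≡.≡-Reasoning
  t = + triℤ k
  u = + triℤ (ℤ.- k)
  lemma₁ : ∀ A B t u → (A ℤ.* t ℤ.+ B ℤ.* u) ℤ.+ (A ℤ.* t ℤ.+ B ℤ.* u) ≡ A ℤ.* (t ℤ.+ t) ℤ.+ B ℤ.* (u ℤ.+ u)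
  lemma₁ = ℤ-Solver.solve-∀
  lemma₂ : ∀ A B k → A ℤ.* (k ℤ.* k ℤ.+ k) ℤ.+ B ℤ.* (ℤ.- k ℤ.* ℤ.- k ℤ.+ ℤ.- k) ≡
    A ℤ.* (k ℤ.* k ℤ.+ k) ℤ.+ B ℤ.* (k ℤ.* k ℤ.- k)
  lemma₂ = ℤ-Solver.solve-∀

double-injective : ∀ m n → + m ℤ.+ + m ≡ + n ℤ.+ + n → m ≡ n
double-injective m n eq = ℕₚ.*-cancelˡ-≡ m n 2
  (≡.subst₂ (λ x y → m ℕ.+ x ≡ n ℕ.+ y) (≡.sym (ℕₚ.+-identityʳ m)) (≡.sym (ℕₚ.+-identityʳ n))
      (ℤₚ.+-injective eq))

double-+ : ∀ x y → (x ℤ.+ y) ℤ.+ (x ℤ.+ y) ≡ (x ℤ.+ x) ℤ.+ (y ℤ.+ y)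
double-+ = ℤ-Solver.solve-∀

expo-+-double : ∀ A B j C D i → let e = expo A B j ℕ.+ expo C D i in
  + e ℤ.+ + e ≡ (+ A ℤ.* (j ℤ.* j ℤ.+ j) ℤ.+ + B ℤ.* (j ℤ.* j ℤ.- j)) ℤ.+
    (+ C ℤ.* (i ℤ.* i ℤ.+ i) ℤ.+ + D ℤ.* (i ℤ.* i ℤ.- i))
expo-+-double A B j C D i = ≡.trans (double-+ (+ expo A B j) (+ expo C D i))
  (≡.cong₂ ℤ._+_ (expo-double A B j) (expo-double C D i))

-- With B = A + F + G, C = A + G and D = A + F one has A + B = C + D. This cancels the cross terms
-- in i j, so that the exponent separates into a part in j and a part in i.
expo-rotate-even : ∀ A F G j i →
  expo A (A ℕ.+ (F ℕ.+ G)) (j ℤ.+ i) ℕ.+ expo (A ℕ.+ G) (A ℕ.+ F) (j ℤ.- i) ≡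
  expo (A ℕ.+ (A ℕ.+ G)) ((A ℕ.+ (F ℕ.+ G)) ℕ.+ (A ℕ.+ F)) j ℕ.+
  expo (A ℕ.+ (A ℕ.+ F)) ((A ℕ.+ (F ℕ.+ G)) ℕ.+ (A ℕ.+ G)) i
expo-rotate-even A F G j i = double-injective _ _ (≡.trans
  (expo-+-double A (A ℕ.+ (F ℕ.+ G)) (j ℤ.+ i) (A ℕ.+ G) (A ℕ.+ F) (j ℤ.- i))
  (≡.trans (lemma (+ A) (+ F) (+ G) j i) (≡.sym
  (expo-+-double (A ℕ.+ (A ℕ.+ G)) ((A ℕ.+ (F ℕ.+ G)) ℕ.+ (A ℕ.+ F)) j (A ℕ.+ (A ℕ.+ F))
      ((A ℕ.+ (F ℕ.+ G)) ℕ.+ (A ℕ.+ G)) i))))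
  where
  lemma : ∀ A F G j i →
    (A ℤ.* ((j ℤ.+ i) ℤ.* (j ℤ.+ i) ℤ.+ (j ℤ.+ i)) ℤ.+ (A ℤ.+ (F ℤ.+ G)) ℤ.*
        ((j ℤ.+ i) ℤ.* (j ℤ.+ i) ℤ.- (j ℤ.+ i))) ℤ.+
    ((A ℤ.+ G) ℤ.* ((j ℤ.- i) ℤ.* (j ℤ.- i) ℤ.+ (j ℤ.- i)) ℤ.+ (A ℤ.+ F) ℤ.*
        ((j ℤ.- i) ℤ.* (j ℤ.- i) ℤ.- (j ℤ.- i))) ≡
    ((A ℤ.+ (A ℤ.+ G)) ℤ.* (j ℤ.* j ℤ.+ j) ℤ.+ ((A ℤ.+ (F ℤ.+ G)) ℤ.+ (A ℤ.+ F)) ℤ.* (j ℤ.* j ℤ.- j)) ℤ.+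
    ((A ℤ.+ (A ℤ.+ F)) ℤ.* (i ℤ.* i ℤ.+ i) ℤ.+ ((A ℤ.+ (F ℤ.+ G)) ℤ.+ (A ℤ.+ G)) ℤ.* (i ℤ.* i ℤ.- i))
  lemma = ℤ-Solver.solve-∀

expo-rotate-odd : ∀ A F G j i → let s = A ℕ.+ (A ℕ.+ (F ℕ.+ G)) in
  expo A (A ℕ.+ (F ℕ.+ G)) (ℤ.suc (j ℤ.+ i)) ℕ.+ expo (A ℕ.+ G) (A ℕ.+ F) (j ℤ.- i) ≡
  A ℕ.+ (expo (s ℕ.+ (A ℕ.+ (A ℕ.+ G))) F j ℕ.+ expo (s ℕ.+ (A ℕ.+ (A ℕ.+ F))) G i)
expo-rotate-odd A F G j i = double-injective _ _ (≡.trans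
  (expo-+-double A (A ℕ.+ (F ℕ.+ G)) (ℤ.suc (j ℤ.+ i)) (A ℕ.+ G) (A ℕ.+ F) (j ℤ.- i))
  (≡.trans (lemma (+ A) (+ F) (+ G) j i) (≡.sym
  (≡.trans (double-+ (+ A) (+ expo (s ℕ.+ (A ℕ.+ (A ℕ.+ G))) F j ℤ.+ + expo (s ℕ.+ (A ℕ.+ (A ℕ.+ F))) G i))
    (≡.cong (λ z → (+ A ℤ.+ + A) ℤ.+ z)
      (expo-+-double (s ℕ.+ (A ℕ.+ (A ℕ.+ G))) F j (s ℕ.+ (A ℕ.+ (A ℕ.+ F))) G i))))))
  where
  s = A ℕ.+ (A ℕ.+ (F ℕ.+ G))
  lemma : ∀ A F G j i →
    (A ℤ.* ((1ℤ ℤ.+ (j ℤ.+ i)) ℤ.* (1ℤ ℤ.+ (j ℤ.+ i)) ℤ.+ (1ℤ ℤ.+ (j ℤ.+ i))) ℤ.+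
      (A ℤ.+ (F ℤ.+ G)) ℤ.* ((1ℤ ℤ.+ (j ℤ.+ i)) ℤ.* (1ℤ ℤ.+ (j ℤ.+ i)) ℤ.- (1ℤ ℤ.+ (j ℤ.+ i)))) ℤ.+
    ((A ℤ.+ G) ℤ.* ((j ℤ.- i) ℤ.* (j ℤ.- i) ℤ.+ (j ℤ.- i)) ℤ.+ (A ℤ.+ F) ℤ.*
        ((j ℤ.- i) ℤ.* (j ℤ.- i) ℤ.- (j ℤ.- i))) ≡
    (A ℤ.+ A) ℤ.+
    ((((A ℤ.+ (A ℤ.+ (F ℤ.+ G))) ℤ.+ (A ℤ.+ (A ℤ.+ G))) ℤ.* (j ℤ.* j ℤ.+ j) ℤ.+ F ℤ.* (j ℤ.* j ℤ.- j)) ℤ.+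
    (((A ℤ.+ (A ℤ.+ (F ℤ.+ G))) ℤ.+ (A ℤ.+ (A ℤ.+ F))) ℤ.* (i ℤ.* i ℤ.+ i) ℤ.+ G ℤ.* (i ℤ.* i ℤ.- i)))
  lemma = ℤ-Solver.solve-∀

expo-suc : ∀ A B n → A ℕ.+ (A ℕ.+ B) ℕ.* n ℕ.+ expo A B (+ n) ≡ expo A B (+ suc n)
expo-suc A B n = double-injective _ _ (≡.trans
  (≡.trans (≡.cong (λ z → (z ℤ.+ + expo A B (+ n)) ℤ.+ (z ℤ.+ + expo A B (+ n)))
      (≡.cong (λ w → + A ℤ.+ w) (ℤₚ.pos-* (A ℕ.+ B) n)))
  (≡.trans (double-+ (+ A ℤ.+ + (A ℕ.+ B) ℤ.* + n) (+ expo A B (+ n)))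
    (≡.cong (λ z → ((+ A ℤ.+ + (A ℕ.+ B) ℤ.* + n) ℤ.+ (+ A ℤ.+ + (A ℕ.+ B) ℤ.* + n)) ℤ.+ z)
        (expo-double A B (+ n)))))
  (≡.trans (lemma (+ A) (+ B) (+ n)) (≡.sym (expo-double A B (+ suc n)))))
  where
  lemma : ∀ A B n → ((A ℤ.+ (A ℤ.+ B) ℤ.* n) ℤ.+ (A ℤ.+ (A ℤ.+ B) ℤ.* n)) ℤ.+
      (A ℤ.* (n ℤ.* n ℤ.+ n) ℤ.+ B ℤ.* (n ℤ.* n ℤ.- n)) ≡
    A ℤ.* ((1ℤ ℤ.+ n) ℤ.* (1ℤ ℤ.+ n) ℤ.+ (1ℤ ℤ.+ n)) ℤ.+ B ℤ.* ((1ℤ ℤ.+ n) ℤ.* (1ℤ ℤ.+ n) ℤ.- (1ℤ ℤ.+ n))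
  lemma = ℤ-Solver.solve-∀

-- This comes from expo (k + 1) = expo k + A + (A + B) k. Writing j for k + 1 + b keeps all
-- exponents natural although k may be negative.
expo-pred : ∀ A B b j k → ℤ.suc k ℤ.+ + b ≡ + j →
  (B ℕ.+ (A ℕ.+ B) ℕ.* b) ℕ.+ expo A B (ℤ.suc k) ≡ (A ℕ.+ B) ℕ.* j ℕ.+ expo A B k
expo-pred A B b j k eq = double-injective _ _ (≡.trans
  (≡.trans (≡.cong (λ z → (z ℤ.+ e₁) ℤ.+ (z ℤ.+ e₁)) (≡.cong (λ w → + B ℤ.+ w) (ℤₚ.pos-* (A ℕ.+ B) b)))
  (≡.trans (double-+ (+ B ℤ.+ + (A ℕ.+ B) ℤ.* + b) e₁)
    (≡.cong (λ z → ((+ B ℤ.+ + (A ℕ.+ B) ℤ.* + b) ℤ.+ (+ B ℤ.+ + (A ℕ.+ B) ℤ.* + b)) ℤ.+ z)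
        (expo-double A B (ℤ.suc k)))))
  (≡.trans (lemma (+ A) (+ B) (+ b) k) (≡.sym
  (≡.trans (≡.cong (λ z → (z ℤ.+ e₀) ℤ.+ (z ℤ.+ e₀))
      (≡.trans (ℤₚ.pos-* (A ℕ.+ B) j) (≡.cong (λ w → + (A ℕ.+ B) ℤ.* w) (≡.sym eq))))
  (≡.trans (double-+ (+ (A ℕ.+ B) ℤ.* (ℤ.suc k ℤ.+ + b)) e₀)
    (≡.cong (λ z → (+ (A ℕ.+ B) ℤ.* (ℤ.suc k ℤ.+ + b) ℤ.+ + (A ℕ.+ B) ℤ.* (ℤ.suc k ℤ.+ + b)) ℤ.+ z)
        (expo-double A B k)))))))
  where
  e₀ = + expo A B k
  e₁ = + expo A B (ℤ.suc k)
  lemma : ∀ A B b k → ((B ℤ.+ (A ℤ.+ B) ℤ.* b) ℤ.+ (B ℤ.+ (A ℤ.+ B) ℤ.* b)) ℤ.+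
      (A ℤ.* ((1ℤ ℤ.+ k) ℤ.* (1ℤ ℤ.+ k) ℤ.+ (1ℤ ℤ.+ k)) ℤ.+ B ℤ.* ((1ℤ ℤ.+ k) ℤ.* (1ℤ ℤ.+ k) ℤ.- (1ℤ ℤ.+ k))) ≡
    ((A ℤ.+ B) ℤ.* ((1ℤ ℤ.+ k) ℤ.+ b) ℤ.+ (A ℤ.+ B) ℤ.* ((1ℤ ℤ.+ k) ℤ.+ b)) ℤ.+
      (A ℤ.* (k ℤ.* k ℤ.+ k) ℤ.+ B ℤ.* (k ℤ.* k ℤ.- k))
  lemma = ℤ-Solver.solve-∀

n≤a*n : ∀ {a} n → 0 ℕ.< a → n ℕ.≤ a ℕ.* n
n≤a*n {suc a} n _ = ℕₚ.m≤m+n n _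

∣k∣≤expo : ∀ {A B} k → 0 ℕ.< A → 0 ℕ.< B → ∣ k ∣ ℕ.≤ expo A B k
∣k∣≤expo (+ n)    a b = ℕₚ.≤-trans (ℕₚ.≤-trans (n≤tri n) (n≤a*n (tri n) a)) (ℕₚ.m≤m+n _ _)
∣k∣≤expo -[1+ n ] a b = ℕₚ.≤-trans (ℕₚ.≤-trans (n≤tri (suc n)) (n≤a*n (tri (suc n)) b)) (ℕₚ.m≤n+m _ _)

-- Finite products: splitting, rearranging and iterating recurrences

module FiniteProducts {r ℓ} (R : CommutativeRing r ℓ) where
  open CommutativeRing R
  open NaturalSolver commutativeSemiring

  prod : ℕ → (ℕ → Carrier) → Carrier
  prod zero    f = 1#
  prod (suc n) f = prod n f * f n

  prod-cong : ∀ n {f g} → (∀ i → f i ≈ g i) → prod n f ≈ prod n g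
  prod-cong zero    e = refl
  prod-cong (suc n) e = *-cong (prod-cong n e) (e n)

  prod-* : ∀ n f g → prod n (λ i → f i * g i) ≈ prod n f * prod n g
  prod-* zero    f g = sym (*-identityˡ 1#)
  prod-* (suc n) f g = trans (*-congʳ (prod-* n f g))
    (solve 4 (λ a b c d → (a :* b) :* (c :* d) := (a :* c) :* (b :* d)) refl _ _ _ _)

  prod-head : ∀ n f → prod (suc n) f ≈ f 0 * prod n (λ i → f (suc i))
  prod-head zero    f = *-comm _ _
  prod-head (suc n) f = trans (*-congʳ (prod-head n f)) (*-assoc _ _ _)

  prod-one : ∀ n {f} → (∀ i → f i ≈ 1#) → prod n f ≈ 1#
  prod-one zero    e = refl
  prod-one (suc n) e = trans (*-cong (prod-one n e) (e n)) (*-identityˡ 1#)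

  prod-append : ∀ m n f → prod (m ℕ.+ n) f ≈ prod n f * prod m (λ i → f (n ℕ.+ i))
  prod-append zero    n f = sym (*-identityʳ _)
  prod-append (suc m) n f = trans
    (*-cong (prod-append m n f) (reflexive (≡.cong f (ℕₚ.+-comm m n)))) (*-assoc _ _ _)

  prod-extend : ∀ {n f} → (∀ i → n ℕ.≤ i → f i ≈ 1#) → ∀ d → prod (d ℕ.+ n) f ≈ prod n f
  prod-extend {n} {f} e d = trans (prod-append d n f)
    (trans (*-congˡ (prod-one d (λ i → e _ (ℕₚ.m≤m+n n i)))) (*-identityʳ _))

  prod-parity : ∀ n f → prod (n ℕ.+ n) f ≈ prod n (λ i → f (i ℕ.+ i)) * prod n (λ i → f (suc (i ℕ.+ i)))
  prod-parity zero    f = sym (*-identityˡ 1#)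
  prod-parity (suc n) f rewrite ℕₚ.+-suc n n = trans (*-congʳ (*-congʳ (prod-parity n f)))
    (solve 4 (λ a b c d → ((a :* b) :* c) :* d := (a :* c) :* (b :* d)) refl _ _ _ _)

  prod-iterate : ∀ n f (F : ℕ → Carrier) → (∀ i → F (suc i) ≈ f i * F i) → F n ≈ prod n f * F 0
  prod-iterate zero    f F e = sym (*-identityˡ _)
  prod-iterate (suc n) f F e = trans (e n) (trans (*-congˡ (prod-iterate n f F e))
    (solve 3 (λ a b c → a :* (b :* c) := (b :* a) :* c) refl _ _ _))

  prod-iterate⁻ : ∀ n f (F : ℕ → Carrier) → (∀ i → F i ≈ f i * F (suc i)) → F 0 ≈ prod n f * F n
  prod-iterate⁻ zero    f F e = sym (*-identityˡ _)
  prod-iterate⁻ (suc n) f F e = trans (prod-iterate⁻ n f F e) (trans (*-congˡ (e n)) (sym (*-assoc _ _ _)))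

-- Theta series modulo q^M, Ramanujan's product formula and Jacobi's triple product

module _ {r ℓ} (R : CommutativeRing r ℓ) where
  open CommutativeRing R
  open RawSemiringDefinitions (Semiring.rawSemiring semiring) using (_^_)

  PowerVanishes : Carrier → ℕ → Set ℓ
  PowerVanishes q M = q ^ M ≈ 0#

module Theta {r ℓ} (R : CommutativeRing r ℓ)
  (q : CommutativeRing.Carrier R) (M : ℕ) (q^M≈0 : PowerVanishes R q M) where

  open CommutativeRing R
  open RawSemiringDefinitions (Semiring.rawSemiring semiring) using (_^_)
  open import Algebra.Properties.Semiring.Exp semiring using (^-homo-*)
  open FiniteSums R public
  open FiniteProducts R public
  open import Relation.Binary.Reasoning.Setoid setoid
  open NaturalSolver commutativeSemiring
  open RingProperties ring using (-1*x≈-x; -‿involutive)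

  q^≈0 : ∀ {n} → M ℕ.≤ n → q ^ n ≈ 0#
  q^≈0 {n} M≤n = begin
    q ^ n                     ≡⟨ ≡.cong (q ^_) (≡.sym (ℕₚ.m+[n∸m]≡n M≤n)) ⟩
    q ^ (M ℕ.+ (n ℕ.∸ M))     ≈⟨ ^-homo-* q M _ ⟩
    q ^ M * q ^ (n ℕ.∸ M)     ≈⟨ *-congʳ q^M≈0 ⟩
    0# * q ^ (n ℕ.∸ M)        ≈⟨ zeroˡ _ ⟩
    0#                        ∎

  q^-+ : ∀ m n {k} → m ℕ.+ n ≡ k → q ^ m * q ^ n ≈ q ^ k
  q^-+ m n ≡.refl = sym (^-homo-* q m n)

  1^n≈1 : ∀ n → 1# ^ n ≈ 1#
  1^n≈1 zero    = refl
  1^n≈1 (suc n) = trans (*-identityˡ _) (1^n≈1 n)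

  Sign : Carrier → Set ℓ
  Sign ε = ε * ε ≈ 1#

  Sign-1 : Sign 1#
  Sign-1 = *-identityˡ 1#

  Sign-−1 : Sign (- 1#)
  Sign-−1 = trans (-1*x≈-x _) (-‿involutive 1#)

  sgn : Carrier → ℤ → Carrier
  sgn ε k = ε ^ ∣ k ∣

  module _ {ε : Carrier} (ε² : Sign ε) where

    sgn-suc : ∀ k → sgn ε (ℤ.suc k) ≈ ε * sgn ε k
    sgn-suc (+ n)          = refl
    sgn-suc -[1+ zero ]    = sym (trans (*-congˡ (*-identityʳ ε)) ε²)
    sgn-suc -[1+ suc n ]   = sym (trans (sym (*-assoc _ _ _)) (trans (*-congʳ ε²) (*-identityˡ _)))

    ^-square : ∀ n → ε ^ n * ε ^ n ≈ 1#
    ^-square zero    = *-identityˡ 1#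
    ^-square (suc n) = trans (solve 2 (λ a b → (a :* b) :* (a :* b) := (a :* a) :* (b :* b)) refl _ _)
      (trans (*-cong ε² (^-square n)) (*-identityˡ 1#))

    sgn-+⁺ : ∀ n j → sgn ε (+ n ℤ.+ j) ≈ ε ^ n * sgn ε j
    sgn-+⁺ zero    j = trans (reflexive (≡.cong (sgn ε) (ℤₚ.+-identityˡ j))) (sym (*-identityˡ _))
    sgn-+⁺ (suc n) j = begin
      sgn ε (+ suc n ℤ.+ j)         ≡⟨ ≡.cong (sgn ε) (ℤₚ.+-assoc 1ℤ (+ n) j) ⟩
      sgn ε (ℤ.suc (+ n ℤ.+ j))     ≈⟨ sgn-suc (+ n ℤ.+ j) ⟩
      ε * sgn ε (+ n ℤ.+ j)         ≈⟨ *-congˡ (sgn-+⁺ n j) ⟩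
      ε * (ε ^ n * sgn ε j)         ≈⟨ *-assoc _ _ _ ⟨
      ε ^ suc n * sgn ε j           ∎

    sgn-+ : ∀ i j → sgn ε (i ℤ.+ j) ≈ sgn ε i * sgn ε j
    sgn-+ (+ n)    j = sgn-+⁺ n j
    sgn-+ -[1+ n ] j = sym (begin
      ε ^ suc n * sgn ε j
        ≡⟨ ≡.cong (λ k → ε ^ suc n * sgn ε k) (≡.sym (i+[-i+s]≡s (+ suc n) j)) ⟩
      ε ^ suc n * sgn ε (+ suc n ℤ.+ (-[1+ n ] ℤ.+ j))
        ≈⟨ *-congˡ (sgn-+⁺ (suc n) (-[1+ n ] ℤ.+ j)) ⟩
      ε ^ suc n * (ε ^ suc n * sgn ε (-[1+ n ] ℤ.+ j))
        ≈⟨ *-assoc _ _ _ ⟨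
      (ε ^ suc n * ε ^ suc n) * sgn ε (-[1+ n ] ℤ.+ j)
        ≈⟨ trans (*-congʳ (^-square (suc n))) (*-identityˡ _) ⟩
      sgn ε (-[1+ n ] ℤ.+ j) ∎)

    sgn-rotate : ∀ j i → sgn ε (j ℤ.+ i) * sgn ε (j ℤ.- i) ≈ 1#
    sgn-rotate j i = begin
      sgn ε (j ℤ.+ i) * sgn ε (j ℤ.- i)
        ≈⟨ *-cong (sgn-+ j i) (trans (sgn-+ j (ℤ.- i)) (*-congˡ (reflexive (≡.cong (ε ^_) (ℤₚ.∣-i∣≡∣i∣ i))))) ⟩
      (sgn ε j * sgn ε i) * (sgn ε j * sgn ε i)
        ≈⟨ solve 2 (λ a b → (a :* b) :* (a :* b) := (a :* a) :* (b :* b)) refl _ _ ⟩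
      (sgn ε j * sgn ε j) * (sgn ε i * sgn ε i)
        ≈⟨ *-cong (^-square ∣ j ∣) (^-square ∣ i ∣) ⟩
      1# * 1#
        ≈⟨ *-identityˡ 1# ⟩
      1# ∎

  -- For a = ε q^A and b = ε q^B the sign of the k-th term is ε^(k²), which equals ε^|k| when ε² =
  -- 1.
  term : Carrier → ℕ → ℕ → ℤ → Carrier
  term ε A B k = sgn ε k * q ^ expo A B k

  -- For A, B > 0 the exponent of the k-th term is at least |k|, so all terms outside this window
  -- vanish.
  theta : Carrier → ℕ → ℕ → Carrier
  theta ε A B = sum± M (term ε A B)

  term-vanishes : ∀ {ε A B} → 0 ℕ.< A → 0 ℕ.< B → Vanishes M (term ε A B)
  term-vanishes a b k lt = trans
    (*-congˡ (q^≈0 (ℕₚ.≤-trans (ℕₚ.<⇒≤ lt) (∣k∣≤expo k a b)))) (zeroʳ _)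

  theta-sym : ∀ ε A B → theta ε A B ≈ theta ε B A
  theta-sym ε A B = trans (sym (sum±-reflect M _)) (sum±-cong M (λ k → *-cong
    (reflexive (≡.cong (ε ^_) (ℤₚ.∣-i∣≡∣i∣ k)))
    (reflexive (≡.cong (q ^_) (≡.trans
      (≡.cong (λ z → A ℕ.* triℤ (ℤ.- k) ℕ.+ B ℕ.* triℤ z) (ℤₚ.neg-involutive k))
          (ℕₚ.+-comm (A ℕ.* triℤ (ℤ.- k)) (B ℕ.* triℤ k)))))))

  sum±-product : ∀ m n f g → sum± m (λ i → sum± n (λ j → f i * g j)) ≈ sum± m f * sum± n g
  sum±-product m n f g = trans (sum±-cong m (λ i → sum±-*ˡ n (f i) g)) (sum±-*ʳ m _ f)

  theta-bound : ∀ {ε A B} m → 0 ℕ.< A → 0 ℕ.< B → M ℕ.≤ m → sum± m (term ε A B) ≈ theta ε A B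
  theta-bound m a b M≤m = sum±-bound (Vanishes-mono M≤m (term-vanishes a b)) (term-vanishes a b)

  -- Ramanujan's f(a,b) f(c,d) = f(ac,bd) f(ad,bc) + a f(b/c,ac²d) f(b/d,acd²) for ab = cd. The
  -- parameters F and G are the exponents of b/c and b/d, so ab = cd holds by construction and no
  -- exponent is subtracted. On the right only ε² = 1 enters the arguments, which is why the theta
  -- functions there have sign `1#`.
  theta-product : ∀ {ε} → Sign ε → ∀ A F G → 0 ℕ.< A → 0 ℕ.< F → 0 ℕ.< G →
    let B = A ℕ.+ (F ℕ.+ G); C = A ℕ.+ G; D = A ℕ.+ F in
    theta ε A B * theta ε C D ≈
    theta 1# (A ℕ.+ C) (B ℕ.+ D) * theta 1# (A ℕ.+ D) (B ℕ.+ C) +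
    ε * q ^ A * (theta 1# ((A ℕ.+ B) ℕ.+ (A ℕ.+ C)) F * theta 1# ((A ℕ.+ B) ℕ.+ (A ℕ.+ D)) G)
  theta-product {ε} ε² A F G a f g = begin
    theta ε A B * theta ε C D
      ≈⟨ sum±-product M M _ _ ⟨
    sum± M (λ i → sum± M (λ j → term ε A B i * term ε C D j))
      ≈⟨ sum±-rotate M vanish ⟩
    sum± m (λ j → sum± m (λ i → term ε A B (j ℤ.+ i) * term ε C D (j ℤ.- i))) +
    sum± m (λ j → sum± m (λ i → term ε A B (ℤ.suc (j ℤ.+ i)) * term ε C D (j ℤ.- i)))
      ≈⟨ +-cong (sum±-cong m (λ j → sum±-cong m (even j))) (sum±-cong m (λ j → sum±-cong m (odd j))) ⟩
    sum± m (λ j → sum± m (λ i → term 1# (A ℕ.+ C) (B ℕ.+ D) j * term 1# (A ℕ.+ D) (B ℕ.+ C) i)) +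
    sum± m (λ j → sum± m (λ i → ε * q ^ A * term 1# C′ F j * term 1# D′ G i))
      ≈⟨ +-cong (sum±-product m m _ _) (trans (sum±-product m m _ _) (*-congʳ (sum±-*ˡ m _ _))) ⟩
    sum± m (term 1# (A ℕ.+ C) (B ℕ.+ D)) * sum± m (term 1# (A ℕ.+ D) (B ℕ.+ C)) +
    ε * q ^ A * sum± m (term 1# C′ F) * sum± m (term 1# D′ G)
      ≈⟨ +-cong
        (*-cong (theta-bound m (pos A a) (pos B b) M≤m) (theta-bound m (pos A a) (pos B b) M≤m))
        (trans (*-cong (*-congˡ (theta-bound m (pos (A ℕ.+ B) (pos A a)) f M≤m))
          (theta-bound m (pos (A ℕ.+ B) (pos A a)) g M≤m)) (*-assoc _ _ _)) ⟩
    theta 1# (A ℕ.+ C) (B ℕ.+ D) * theta 1# (A ℕ.+ D) (B ℕ.+ C) +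
    ε * q ^ A * (theta 1# C′ F * theta 1# D′ G) ∎
    where
    B = A ℕ.+ (F ℕ.+ G)
    C = A ℕ.+ G
    D = A ℕ.+ F
    C′ = (A ℕ.+ B) ℕ.+ (A ℕ.+ C)
    D′ = (A ℕ.+ B) ℕ.+ (A ℕ.+ D)
    m = suc (M ℕ.+ M)
    M≤m : M ℕ.≤ m
    M≤m = ℕₚ.≤-trans (ℕₚ.m≤m+n M M) (ℕₚ.n≤1+n _)
    pos : ∀ x {y} → 0 ℕ.< x → 0 ℕ.< x ℕ.+ y
    pos x lt = ℕₚ.<-≤-trans lt (ℕₚ.m≤m+n x _)
    b : 0 ℕ.< B
    b = pos A a
    vanish : Vanishes₂ M (λ i j → term ε A B i * term ε C D j)
    vanish i j (inj₁ lt) = trans (*-congʳ (term-vanishes a b i lt)) (zeroˡ _)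
    vanish i j (inj₂ lt) = trans (*-congˡ (term-vanishes (pos A a) (pos A a) j lt)) (zeroʳ _)
    even : ∀ j i → term ε A B (j ℤ.+ i) * term ε C D (j ℤ.- i) ≈
      term 1# (A ℕ.+ C) (B ℕ.+ D) j * term 1# (A ℕ.+ D) (B ℕ.+ C) i
    even j i = begin
      (s₁ * q ^ e₁) * (s₂ * q ^ e₂)
        ≈⟨ solve 4 (λ a b c d → (a :* b) :* (c :* d) := (a :* c) :* (b :* d)) refl _ _ _ _ ⟩
      (s₁ * s₂) * (q ^ e₁ * q ^ e₂)
        ≈⟨ *-cong (sgn-rotate ε² j i) (trans (q^-+ e₁ e₂ (expo-rotate-even A F G j i)) (^-homo-* q e₃ e₄)) ⟩
      1# * (q ^ e₃ * q ^ e₄)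
        ≈⟨ solve 2 (λ a b → con 1 :* (a :* b) := (con 1 :* a) :* (con 1 :* b)) refl _ _ ⟩
      (1# * q ^ e₃) * (1# * q ^ e₄)
        ≈⟨ *-cong (*-congʳ (1^n≈1 ∣ j ∣)) (*-congʳ (1^n≈1 ∣ i ∣)) ⟨
      (sgn 1# j * q ^ e₃) * (sgn 1# i * q ^ e₄) ∎
      where
      s₁ = sgn ε (j ℤ.+ i)
      s₂ = sgn ε (j ℤ.- i)
      e₁ = expo A B (j ℤ.+ i)
      e₂ = expo C D (j ℤ.- i)
      e₃ = expo (A ℕ.+ C) (B ℕ.+ D) j
      e₄ = expo (A ℕ.+ D) (B ℕ.+ C) i
    odd : ∀ j i → term ε A B (ℤ.suc (j ℤ.+ i)) * term ε C D (j ℤ.- i) ≈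
      ε * q ^ A * term 1# C′ F j * term 1# D′ G i
    odd j i = begin
      (sgn ε (ℤ.suc (j ℤ.+ i)) * q ^ e₁) * (s₂ * q ^ e₂)
        ≈⟨ *-congʳ (*-congʳ (sgn-suc ε² (j ℤ.+ i))) ⟩
      ((ε * s₁) * q ^ e₁) * (s₂ * q ^ e₂)
        ≈⟨ solve 5 (λ e a b c d → ((e :* a) :* b) :* (c :* d) := (e :* (a :* c)) :* (b :* d)) refl _ _ _ _ _ ⟩
      (ε * (s₁ * s₂)) * (q ^ e₁ * q ^ e₂)
        ≈⟨ *-cong (*-congˡ (sgn-rotate ε² j i)) (trans (q^-+ e₁ e₂ (expo-rotate-odd A F G j i))
          (trans (^-homo-* q A _) (*-congˡ (^-homo-* q e₃ e₄)))) ⟩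
      (ε * 1#) * (q ^ A * (q ^ e₃ * q ^ e₄))
        ≈⟨ solve 4 (λ e x a b → (e :* con 1) :* (x :* (a :* b)) := ((e :* x) :* (con 1 :* a)) :* (con 1 :* b))
            refl _ _ _ _ ⟩
      ε * q ^ A * (1# * q ^ e₃) * (1# * q ^ e₄)
        ≈⟨ *-cong (*-congˡ (*-congʳ (1^n≈1 ∣ j ∣))) (*-congʳ (1^n≈1 ∣ i ∣)) ⟨
      ε * q ^ A * (sgn 1# j * q ^ e₃) * (sgn 1# i * q ^ e₄) ∎
      where
      s₁ = sgn ε (j ℤ.+ i)
      s₂ = sgn ε (j ℤ.- i)
      e₁ = expo A B (ℤ.suc (j ℤ.+ i))
      e₂ = expo C D (j ℤ.- i)
      e₃ = expo C′ F j
      e₄ = expo D′ G i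

  factor : Carrier → ℕ → Carrier
  factor ε n = 1# + ε * q ^ n

  factor≈1 : ∀ ε {n} → M ℕ.≤ n → factor ε n ≈ 1#
  factor≈1 ε M≤n = trans (+-congˡ (trans (*-congˡ (q^≈0 M≤n)) (zeroʳ ε))) (+-identityʳ 1#)

  factor-− : ∀ n x → factor (- 1#) n * x + q ^ n * x ≈ x
  factor-− n x = begin
    (1# + - 1# * q ^ n) * x + q ^ n * x
      ≈⟨ solve 3 (λ e y x → (con 1 :+ e :* y) :* x :+ y :* x := x :+ (e :+ con 1) :* (y :* x)) refl _ _ _ ⟩
    x + (- 1# + 1#) * (q ^ n * x)
      ≈⟨ +-congˡ (trans (*-congʳ (-‿inverseˡ 1#)) (zeroˡ _)) ⟩
    x + 0#
      ≈⟨ +-identityʳ x ⟩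
    x ∎

  -- Jacobi's triple product: with p = q^(A+B) and Q k = ∏_{i>k} (1 − p^i), which is 0 for k < 0, the recurrence
  -- Q (k−1) + p^k Q k = Q k shows that the sums Σ w_k p^(ak) Q k and Σ w_k Q (k+b) over the terms
  -- w_k of the theta function acquire the factors 1 + ε q^A p^a and 1 + ε q^B p^b
  -- when a decreases and b increases by one.
  module TripleProduct {ε : Carrier} (ε² : Sign ε) {A B : ℕ} (0<A : 0 ℕ.< A) (0<B : 0 ℕ.< B)
    (L : ℕ) (2M≤L : M ℕ.+ M ℕ.≤ L) where

    s : ℕ
    s = A ℕ.+ B

    n≤s*n : ∀ n → n ℕ.≤ s ℕ.* n
    n≤s*n n = n≤a*n n (ℕₚ.<-≤-trans 0<A (ℕₚ.m≤m+n A B))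

    M≤L : M ℕ.≤ L
    M≤L = ℕₚ.≤-trans (ℕₚ.m≤m+n M M) 2M≤L

    Q : ℕ → Carrier
    Q j = prod L (λ i → factor (- 1#) (s ℕ.* suc (j ℕ.+ i)))

    Qℤ : ℤ → Carrier
    Qℤ (+ j)    = Q j
    Qℤ -[1+ j ] = 0#

    pQℤ : ℕ → ℤ → Carrier
    pQℤ a (+ j)    = q ^ (s ℕ.* (a ℕ.* j)) * Q j
    pQℤ a -[1+ j ] = 0#

    Q-suc : ∀ j → Q j ≈ factor (- 1#) (s ℕ.* suc j) * Q (suc j)
    Q-suc j = begin
      prod L f
        -- One more factor may be appended, because its exponent s (j + L + 1) is at least M.
        ≈⟨ trans (*-congˡ (factor≈1 _ (ℕₚ.≤-trans M≤L
            (ℕₚ.≤-trans (ℕₚ.≤-trans (ℕₚ.m≤n+m L j) (ℕₚ.n≤1+n _)) (n≤s*n _)))))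
            (*-identityʳ _) ⟨
      prod (suc L) f
        ≈⟨ prod-head L f ⟩
      f 0 * prod L (λ i → f (suc i))
        ≈⟨ *-cong (reflexive (≡.cong (λ z → factor (- 1#) (s ℕ.* suc z)) (ℕₚ.+-identityʳ j)))
            (prod-cong L (λ i → reflexive (≡.cong (λ z → factor (- 1#) (s ℕ.* suc z)) (ℕₚ.+-suc j i)))) ⟩
      factor (- 1#) (s ℕ.* suc j) * Q (suc j) ∎
      where
      f : ℕ → Carrier
      f i = factor (- 1#) (s ℕ.* suc (j ℕ.+ i))

    Q-recurrence : ∀ j → Q j + q ^ (s ℕ.* suc j) * Q (suc j) ≈ Q (suc j)
    Q-recurrence j = trans (+-congʳ (Q-suc j)) (factor-− (s ℕ.* suc j) (Q (suc j)))

    Qℤ-recurrence : ∀ k → Qℤ k + pQℤ 1 (ℤ.suc k) ≈ Qℤ (ℤ.suc k)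
    Qℤ-recurrence (+ j)          = trans (+-congˡ (*-congʳ (reflexive
      (≡.cong (λ z → q ^ (s ℕ.* suc z)) (ℕₚ.+-identityʳ j))))) (Q-recurrence j)
    Qℤ-recurrence -[1+ zero ]    = trans (+-identityˡ _) (trans
      (*-congʳ (reflexive (≡.cong (q ^_) (ℕₚ.*-zeroʳ s)))) (*-identityˡ _))
    Qℤ-recurrence -[1+ suc j ]   = +-identityˡ 0#

    Q≈1 : ∀ {j} → M ℕ.≤ j → Q j ≈ 1#
    Q≈1 {j} M≤j = prod-one L (λ i → factor≈1 _
      (ℕₚ.≤-trans M≤j (ℕₚ.≤-trans (ℕₚ.≤-trans (ℕₚ.m≤m+n j i) (ℕₚ.n≤1+n _)) (n≤s*n _))))

    w : ℤ → Carrier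
    w = term ε A B

    w-vanishes : (f : ℤ → Carrier) → Vanishes M (λ k → w k * f k)
    w-vanishes f k lt = trans (*-congʳ (term-vanishes 0<A 0<B k lt)) (zeroˡ _)

    sum±-suc-M : ∀ {g} → Vanishes M g → Vanishes M (λ k → g (ℤ.suc k)) → sum± M g ≈ sum± M (λ k → g (ℤ.suc k))
    sum±-suc-M v v′ = trans (sum±-suc v) (sum±-extend 1 v′)

    upper : ℕ → Carrier
    upper a = sum± M (λ k → w k * pQℤ a k)

    -- This is p^(ak) Q (k - 1), which is 0 for k ≤ 0.
    shifted : ℕ → ℤ → Carrier
    shifted a (+ zero)    = 0#
    shifted a (+ suc j)   = q ^ (s ℕ.* (a ℕ.* suc j)) * Q j
    shifted a -[1+ j ]    = 0#

    -- Since w_(k+1) = ε q^A p^k w_k, multiplying w_k p^((a+1)k) Q k by ε q^A p^a gives w_(k+1)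
    -- p^(a(k+1)) Q k. After reindexing, the recurrence of Q combines it with the unmultiplied term.
    upper-recurrence : ∀ a → upper a ≈ factor ε (A ℕ.+ s ℕ.* a) * upper (suc a)
    upper-recurrence a = sym (begin
      (1# + ε * q ^ (A ℕ.+ s ℕ.* a)) * upper (suc a)
        ≈⟨ solve 2 (λ x y → (con 1 :+ x) :* y := y :+ x :* y) refl _ _ ⟩
      upper (suc a) + ε * q ^ (A ℕ.+ s ℕ.* a) * upper (suc a)
        ≈⟨ +-congˡ (trans (sym (sum±-*ˡ M _ _)) (sum±-cong M step)) ⟩
      upper (suc a) + sum± M (λ k → w (ℤ.suc k) * shifted a (ℤ.suc k))
        ≈⟨ +-congˡ (sum±-suc-M {λ k → w k * shifted a k} (w-vanishes (shifted a))
            (λ k lt → trans (sym (step k)) (trans (*-congˡ (w-vanishes (pQℤ (suc a)) k lt)) (zeroʳ _)))) ⟨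
      upper (suc a) + sum± M (λ k → w k * shifted a k)
        ≈⟨ sum±-+ M _ _ ⟨
      sum± M (λ k → w k * pQℤ (suc a) k + w k * shifted a k)
        ≈⟨ sum±-cong M (λ k → trans (sym (distribˡ _ _ _)) (*-congˡ (combine k))) ⟩
      upper a ∎)
      where
      step : ∀ k → ε * q ^ (A ℕ.+ s ℕ.* a) * (w k * pQℤ (suc a) k) ≈ w (ℤ.suc k) * shifted a (ℤ.suc k)
      step (+ n) = begin
        ε * q ^ x * ((ε ^ n * q ^ e) * (q ^ y * Q n))
          ≈⟨ solve 6 (λ ε x t e y Q → ε :* x :* ((t :* e) :* (y :* Q)) := (ε :* t) :* ((x :* e) :* y) :* Q) refl
              _ _ _ _ _ _ ⟩
        (ε * ε ^ n) * ((q ^ x * q ^ e) * q ^ y) * Q n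
          ≈⟨ *-congʳ (*-congˡ (trans (*-congʳ (sym (^-homo-* q x e)))
              (trans (q^-+ (x ℕ.+ e) y exponents) (^-homo-* q e′ y′)))) ⟩
        (ε * ε ^ n) * (q ^ e′ * q ^ y′) * Q n
          ≈⟨ solve 4 (λ t e y Q → t :* (e :* y) :* Q := (t :* e) :* (y :* Q)) refl _ _ _ _ ⟩
        (ε * ε ^ n * q ^ e′) * (q ^ y′ * Q n) ∎
        where
        x = A ℕ.+ s ℕ.* a
        y = s ℕ.* (suc a ℕ.* n)
        e = expo A B (+ n)
        e′ = expo A B (+ suc n)
        y′ = s ℕ.* (a ℕ.* suc n)
        rearrange : ∀ A s a n e → ((A ℕ.+ s ℕ.* a) ℕ.+ e) ℕ.+ s ℕ.* ((1 ℕ.+ a) ℕ.* n) ≡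
            ((A ℕ.+ s ℕ.* n) ℕ.+ e) ℕ.+ s ℕ.* (a ℕ.* (1 ℕ.+ n))
        rearrange = ℕ-Solver.solve-∀
        exponents : (x ℕ.+ e) ℕ.+ y ≡ e′ ℕ.+ y′
        exponents = ≡.trans (rearrange A s a n e) (≡.cong (ℕ._+ y′) (expo-suc A B n))
      step -[1+ zero ]  = trans (trans (*-congˡ (zeroʳ _)) (zeroʳ _)) (sym (zeroʳ _))
      step -[1+ suc n ] = trans (trans (*-congˡ (zeroʳ _)) (zeroʳ _)) (sym (zeroʳ _))
      combine : ∀ k → pQℤ (suc a) k + shifted a k ≈ pQℤ a k
      combine (+ zero)  = +-identityʳ _
      combine (+ suc j) = begin
        q ^ (s ℕ.* (suc j ℕ.+ a ℕ.* suc j)) * Q (suc j) + q ^ (s ℕ.* (a ℕ.* suc j)) * Q j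
          ≈⟨ +-congʳ (*-congʳ (trans (reflexive (≡.cong (q ^_) (ℕₚ.*-distribˡ-+ s (suc j) (a ℕ.* suc j))))
              (^-homo-* q (s ℕ.* suc j) _))) ⟩
        q ^ (s ℕ.* suc j) * q ^ (s ℕ.* (a ℕ.* suc j)) * Q (suc j) + q ^ (s ℕ.* (a ℕ.* suc j)) * Q j
          ≈⟨ solve 4 (λ x y Q Q′ → x :* y :* Q′ :+ y :* Q := y :* (Q :+ x :* Q′)) refl _ _ _ _ ⟩
        q ^ (s ℕ.* (a ℕ.* suc j)) * (Q j + q ^ (s ℕ.* suc j) * Q (suc j))
          ≈⟨ *-congˡ (Q-recurrence j) ⟩
        q ^ (s ℕ.* (a ℕ.* suc j)) * Q (suc j) ∎
      combine -[1+ j ] = +-identityˡ 0#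

    lower : ℕ → Carrier
    lower b = sum± M (λ k → w k * Qℤ (k ℤ.+ + b))

    -- Here ε q^B p^b w_(k+1) = w_k p^(k+1+b), so after reindexing the two terms combine by Q (k+b)
    -- + p^(k+1+b) Q (k+1+b) = Q (k+1+b).
    lower-recurrence : ∀ b → lower (suc b) ≈ factor ε (B ℕ.+ s ℕ.* b) * lower b
    lower-recurrence b = sym (begin
      (1# + ε * q ^ y) * lower b
        ≈⟨ solve 2 (λ x y → (con 1 :+ x) :* y := y :+ x :* y) refl _ _ ⟩
      lower b + ε * q ^ y * lower b
        ≈⟨ +-congˡ (sym (sum±-*ˡ M _ _)) ⟩
      lower b + sum± M g
        ≈⟨ +-congˡ (sum±-suc-M {g} (λ k lt → trans (*-congˡ (w-vanishes (λ k → Qℤ (k ℤ.+ + b)) k lt)) (zeroʳ _))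
            (λ k lt → trans (step k) (w-vanishes (λ k → pQℤ 1 (ℤ.suc k ℤ.+ + b)) k lt))) ⟩
      lower b + sum± M (λ k → g (ℤ.suc k))
        ≈⟨ trans (sum±-+ M _ _) (+-congˡ (sum±-cong M (λ k → sym (step k)))) ⟨
      sum± M (λ k → w k * Qℤ (k ℤ.+ + b) + w k * pQℤ 1 (ℤ.suc k ℤ.+ + b))
        ≈⟨ sum±-cong M (λ k → trans (sym (distribˡ _ _ _)) (*-congˡ (combine k))) ⟩
      lower (suc b) ∎)
      where
      y = B ℕ.+ s ℕ.* b
      g : ℤ → Carrier
      g k = ε * q ^ y * (w k * Qℤ (k ℤ.+ + b))
      step : ∀ k → g (ℤ.suc k) ≈ w k * pQℤ 1 (ℤ.suc k ℤ.+ + b)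
      step k with ℤ.suc k ℤ.+ + b in eq
      ... | + j = begin
        ε * q ^ y * (sgn ε (ℤ.suc k) * q ^ e₁ * Q j)
          ≈⟨ *-congˡ (*-congʳ (*-congʳ (sgn-suc ε² k))) ⟩
        ε * q ^ y * (ε * sgn ε k * q ^ e₁ * Q j)
          ≈⟨ solve 5 (λ ε y t e Q → ε :* y :* (ε :* t :* e :* Q) := ((ε :* ε) :* t) :* (y :* e) :* Q) refl _ _ _
              _ _ ⟩
        (ε * ε * sgn ε k) * (q ^ y * q ^ e₁) * Q j
          ≈⟨ *-congʳ (*-cong (trans (*-congʳ ε²) (*-identityˡ _))
              (trans (q^-+ y e₁ (expo-pred A B b j k eq)) (^-homo-* q (s ℕ.* j) e₀))) ⟩
        sgn ε k * (q ^ (s ℕ.* j) * q ^ e₀) * Q j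
          ≈⟨ solve 4 (λ t x e Q → t :* (x :* e) :* Q := t :* e :* (x :* Q)) refl _ _ _ _ ⟩
        sgn ε k * q ^ e₀ * (q ^ (s ℕ.* j) * Q j)
          ≈⟨ *-congˡ (*-congʳ (reflexive (≡.cong (λ z → q ^ (s ℕ.* z)) (≡.sym (ℕₚ.+-identityʳ j))))) ⟩
        sgn ε k * q ^ e₀ * (q ^ (s ℕ.* (j ℕ.+ 0)) * Q j) ∎
        where
        e₀ = expo A B k
        e₁ = expo A B (ℤ.suc k)
      ... | -[1+ j ] = trans (trans (*-congˡ (zeroʳ _)) (zeroʳ _)) (sym (zeroʳ _))
      combine : ∀ k → Qℤ (k ℤ.+ + b) + pQℤ 1 (ℤ.suc k ℤ.+ + b) ≈ Qℤ (k ℤ.+ + suc b)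
      combine k = trans (+-congˡ (reflexive (≡.cong (pQℤ 1) (ℤₚ.+-assoc 1ℤ k (+ b)))))
        (trans (Qℤ-recurrence (k ℤ.+ + b)) (reflexive (≡.cong Qℤ (lemma k (+ b)))))
        where
        lemma : ∀ k b → 1ℤ ℤ.+ (k ℤ.+ b) ≡ k ℤ.+ (1ℤ ℤ.+ b)
        lemma = ℤ-Solver.solve-∀

    -- Only k = 0 survives: for k > 0 the power p^(Lk) vanishes, and for k < 0 the value of `pQℤ` is
    -- 0.
    upper-end : upper L ≈ Q 0
    upper-end = begin
      sum± M (λ k → w k * pQℤ L k)
        ≈⟨ sum±-bound {M} {0} (w-vanishes (pQℤ L)) off-zero ⟩
      w (+ 0) * pQℤ L (+ 0)
        ≈⟨ *-cong
            (trans (*-identityˡ _) (reflexive (≡.cong (q ^_) (≡.cong₂ ℕ._+_ (ℕₚ.*-zeroʳ A) (ℕₚ.*-zeroʳ B)))))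
            (trans (*-congʳ (reflexive (≡.cong (q ^_)
                (≡.trans (≡.cong (s ℕ.*_) (ℕₚ.*-zeroʳ L)) (ℕₚ.*-zeroʳ s))))) (*-identityˡ _)) ⟩
      1# * Q 0
        ≈⟨ *-identityˡ _ ⟩
      Q 0 ∎
      where
      off-zero : Vanishes 0 (λ k → w k * pQℤ L k)
      off-zero (+ suc j) _ = trans (*-congˡ (trans (*-congʳ (q^≈0
        (ℕₚ.≤-trans M≤L (ℕₚ.≤-trans (ℕₚ.m≤m*n L (suc j)) (n≤s*n _))))) (zeroˡ _))) (zeroʳ _)
      off-zero -[1+ j ]  _ = zeroʳ _

    -- For |k| ≤ M the hypothesis L ≥ 2M gives k + L ≥ M, and then all factors of Q (k + L) are 1.
    lower-end : lower L ≈ theta ε A B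
    lower-end = sum±-cong M step
      where
      bound : ∀ k → ∣ k ∣ ℕ.≤ M → M ℕ.≤ ∣ k ℤ.+ + L ∣
      bound k le = ℕₚ.+-cancelˡ-≤ M M _ (ℕₚ.≤-trans 2M≤L (ℕₚ.≤-trans
        (≡.subst₂ (λ x y → x ℕ.≤ y ℕ.+ ∣ k ℤ.+ + L ∣) (≡.cong ∣_∣ (-c+[c+k]≡k k (+ L))) (ℤₚ.∣-i∣≡∣i∣ k)
          (ℤₚ.∣i+j∣≤∣i∣+∣j∣ (ℤ.- k) (k ℤ.+ + L))) (ℕₚ.+-monoˡ-≤ _ le)))
      nonneg : ∀ k → ∣ k ∣ ℕ.≤ M → k ℤ.+ + L ≡ + ∣ k ℤ.+ + L ∣
      nonneg (+ n)    le = ≡.refl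
      nonneg -[1+ n ] le = ≡.trans (ℤₚ.⊖-≥ le′) (≡.sym (≡.cong (λ z → + ∣ z ∣) (ℤₚ.⊖-≥ le′)))
        where le′ = ℕₚ.≤-trans le M≤L
      step : ∀ k → w k * Qℤ (k ℤ.+ + L) ≈ w k
      step k with ∣ k ∣ ℕ.≤? M
      ... | yes le = trans (*-congˡ (trans (reflexive (≡.cong Qℤ (nonneg k le))) (Q≈1 (bound k le))))
          (*-identityʳ _)
      ... | no  gt = trans (w-vanishes (λ k → Qℤ (k ℤ.+ + L)) k (ℕₚ.≰⇒> gt))
          (sym (term-vanishes 0<A 0<B k (ℕₚ.≰⇒> gt)))

    -- The sums `lower` and `upper` coincide at a = b = 0. From there L steps of `lower` lead to the
    -- theta function and L steps of `upper` to Q 0, each step contributing one factor.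
    triple-product : theta ε A B ≈
      prod L (λ b → factor ε (B ℕ.+ s ℕ.* b)) * (prod L (λ a → factor ε (A ℕ.+ s ℕ.* a)) * Q 0)
    triple-product = begin
      theta ε A B
        ≈⟨ lower-end ⟨
      lower L
        ≈⟨ prod-iterate L _ lower lower-recurrence ⟩
      prod L (λ b → factor ε (B ℕ.+ s ℕ.* b)) * lower 0
        ≈⟨ *-congˡ (sum±-cong M initial) ⟩
      prod L (λ b → factor ε (B ℕ.+ s ℕ.* b)) * upper 0
        ≈⟨ *-congˡ (trans (prod-iterate⁻ L _ upper upper-recurrence) (*-congˡ upper-end)) ⟩
      prod L (λ b → factor ε (B ℕ.+ s ℕ.* b)) * (prod L (λ a → factor ε (A ℕ.+ s ℕ.* a)) * Q 0) ∎
      where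
      initial : ∀ k → w k * Qℤ (k ℤ.+ + 0) ≈ w k * pQℤ 0 k
      initial (+ n)    = *-congˡ (trans (reflexive (≡.cong Q (ℕₚ.+-identityʳ n)))
        (trans (sym (*-identityˡ _)) (*-congʳ (reflexive (≡.cong (q ^_) (≡.sym (ℕₚ.*-zeroʳ s)))))))
      initial -[1+ n ] = refl

-- Products of residue classes mod 72

-- The residues mod 72 of the exponents in [A]; by (1 + x)(1 − x) = 1 − x², those in the product {A}[A]
-- are doubled± A.
residues± : ℕ → List ℕ
residues± A = A ∷ A ℕ.+ 36 ∷ 36 ℕ.∸ A ∷ (36 ℕ.∸ A) ℕ.+ 36 ∷ []

doubled± : ℕ → List ℕ
doubled± A = A ℕ.+ A ∷ (36 ℕ.∸ A) ℕ.+ (36 ℕ.∸ A) ∷ []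

-- Reduces the comparison of multisets of residues to a computation, so that `refl` proves it for
-- concrete lists.
sort≡⇒↭ : ∀ xs ys → sort xs ≡ sort ys → xs ↭ ys
sort≡⇒↭ xs ys eq = ↭-trans (↭-sym (sort-↭ xs)) (↭-trans (↭-reflexive eq) (sort-↭ ys))
  where open SortingAlgorithm insertionSort using (sort-↭)

Admissible : List ℕ → Set
Admissible = All (λ A → 0 ℕ.< A × A ℕ.< 36)

module Modulus72 {r ℓ} (R : CommutativeRing r ℓ)
  (q : CommutativeRing.Carrier R) (M : ℕ) (q^M≈0 : PowerVanishes R q M) where

  open CommutativeRing R
  open RawSemiringDefinitions (Semiring.rawSemiring semiring) using (_^_)
  open import Algebra.Properties.Semiring.Exp semiring using (^-assocʳ; ^-congʳ)
  open Theta R q M q^M≈0 public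
  open import Relation.Binary.Reasoning.Setoid setoid
  open NaturalSolver commutativeSemiring

  Unit : Carrier → Set _
  Unit x = ∃ λ y → x * y ≈ 1#

  Unit-cancel : ∀ {u x y} → Unit u → u * x ≈ u * y → x ≈ y
  Unit-cancel {u} {x} {y} (v , uv) eq = begin
    x             ≈⟨ *-identityˡ x ⟨
    1# * x        ≈⟨ *-congʳ uv ⟨
    (u * v) * x   ≈⟨ solve 3 (λ u v x → (u :* v) :* x := v :* (u :* x)) refl _ _ _ ⟩
    v * (u * x)   ≈⟨ *-congˡ eq ⟩
    v * (u * y)   ≈⟨ solve 3 (λ u v x → v :* (u :* x) := (u :* v) :* x) refl _ _ _ ⟩
    (u * v) * y   ≈⟨ *-congʳ uv ⟩
    1# * y        ≈⟨ *-identityˡ y ⟩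
    y             ∎

  Unit-cong : ∀ {x y} → x ≈ y → Unit y → Unit x
  Unit-cong eq (v , yv) = v , trans (*-congʳ eq) yv

  Unit-1 : Unit 1#
  Unit-1 = 1# , *-identityˡ 1#

  Unit-* : ∀ {x y} → Unit x → Unit y → Unit (x * y)
  Unit-* (v , xv) (w , yw) = v * w , trans
    (solve 4 (λ x y v w → (x :* y) :* (v :* w) := (x :* v) :* (y :* w)) refl _ _ _ _)
    (trans (*-cong xv yw) (*-identityˡ 1#))

  Unit-^ : ∀ {x} n → Unit x → Unit (x ^ n)
  Unit-^ zero    u = Unit-1
  Unit-^ (suc n) u = Unit-* u (Unit-^ n u)

  Unit-prod : ∀ n {f} → (∀ i → Unit (f i)) → Unit (prod n f)
  Unit-prod zero    u = Unit-1
  Unit-prod (suc n) u = Unit-* (Unit-prod n u) (u n)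

  geometric : ℕ → ℕ → Carrier
  geometric n zero    = 0#
  geometric n (suc m) = 1# + q ^ n * geometric n m

  geometric-sum : ∀ n m → factor (- 1#) n * geometric n m + (q ^ n) ^ m ≈ 1#
  geometric-sum n zero    = trans (+-congʳ (zeroʳ _)) (+-identityˡ 1#)
  geometric-sum n (suc m) = begin
    (1# + - 1# * x) * (1# + x * g) + x * x ^ m
      ≈⟨ solve 4 (λ e x g y → (con 1 :+ e :* x) :* (con 1 :+ x :* g) :+ x :* y :=
            (con 1 :+ e :* x) :* con 1 :+ x :* ((con 1 :+ e :* x) :* g :+ y)) refl _ _ _ _ ⟩
    (1# + - 1# * x) * 1# + x * ((1# + - 1# * x) * g + x ^ m)
      ≈⟨ +-congˡ (*-congˡ (geometric-sum n m)) ⟩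
    (1# + - 1# * x) * 1# + x * 1#
      ≈⟨ factor-− n 1# ⟩
    1# ∎
    where
    x = q ^ n
    g = geometric n m

  -- The inverse is a geometric series with M terms; its remainder q^(nM) vanishes since n > 0.
  Unit-factor : ∀ {n} → 0 ℕ.< n → Unit (factor (- 1#) n)
  Unit-factor {n} lt = geometric n M , (begin
    factor (- 1#) n * geometric n M
      ≈⟨ +-identityʳ _ ⟨
    factor (- 1#) n * geometric n M + 0#
      ≈⟨ +-congˡ (trans (^-assocʳ q n M) (q^≈0 (n≤a*n M lt))) ⟨
    factor (- 1#) n * geometric n M + (q ^ n) ^ M
      ≈⟨ geometric-sum n M ⟩
    1# ∎)

  P : ℕ → Carrier
  P r = prod M (λ i → factor (- 1#) (r ℕ.+ 72 ℕ.* i))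

  Unit-P : ∀ {r} → 0 ℕ.< r → Unit (P r)
  Unit-P lt = Unit-prod M (λ i → Unit-factor (ℕₚ.<-≤-trans lt (ℕₚ.m≤m+n _ _)))

  Π : List ℕ → Carrier
  Π []      = 1#
  Π (r ∷ l) = P r * Π l

  Unit-Π : ∀ {l} → All (0 ℕ.<_) l → Unit (Π l)
  Unit-Π []        = Unit-1
  Unit-Π (lt ∷ ps) = Unit-* (Unit-P lt) (Unit-Π ps)

  Π-++ : ∀ k l → Π (k ++ l) ≈ Π k * Π l
  Π-++ []      l = sym (*-identityˡ _)
  Π-++ (r ∷ k) l = trans (*-congˡ (Π-++ k l)) (sym (*-assoc _ _ _))

  Π-↭ : ∀ {k l} → k ↭ l → Π k ≈ Π l
  Π-↭ Perm.refl          = refl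
  Π-↭ (prep r p)        = *-congˡ (Π-↭ p)
  Π-↭ (swap r s p)      = trans (*-congˡ (*-congˡ (Π-↭ p)))
    (solve 3 (λ a b c → a :* (b :* c) := b :* (a :* c)) refl _ _ _)
  Π-↭ (Perm.trans p p′)  = trans (Π-↭ p) (Π-↭ p′)

  -- The length M + M serves two purposes: it is the L of the triple product, and splitting the
  -- index by parity leaves exactly the M factors of each `P`.
  E36 : Carrier → ℕ → Carrier
  E36 ε A = prod (M ℕ.+ M) (λ i → factor ε (A ℕ.+ 36 ℕ.* i))

  J : Carrier
  J = prod (M ℕ.+ M) (λ i → factor (- 1#) (36 ℕ.* suc i))

  Unit-J : Unit J
  Unit-J = Unit-prod (M ℕ.+ M) (λ i → Unit-factor {36 ℕ.* suc i} (s≤s z≤n))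

  E36-split : ∀ A → E36 (- 1#) A ≈ P A * P (A ℕ.+ 36)
  E36-split A = trans (prod-parity M _) (*-cong
    (prod-cong M (λ i → reflexive (≡.cong (factor (- 1#)) (even A i))))
    (prod-cong M (λ i → reflexive (≡.cong (factor (- 1#)) (odd A i)))))
    where
    even : ∀ A i → A ℕ.+ 36 ℕ.* (i ℕ.+ i) ≡ A ℕ.+ 72 ℕ.* i
    even = ℕ-Solver.solve-∀
    odd : ∀ A i → A ℕ.+ 36 ℕ.* (1 ℕ.+ (i ℕ.+ i)) ≡ (A ℕ.+ 36) ℕ.+ 72 ℕ.* i
    odd = ℕ-Solver.solve-∀

  factor-fuse : ∀ n → factor 1# n * factor (- 1#) n ≈ factor (- 1#) (n ℕ.+ n)
  factor-fuse n = begin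
    (1# + 1# * x) * (1# + - 1# * x)
      ≈⟨ solve 2 (λ e x → (con 1 :+ con 1 :* x) :* (con 1 :+ e :* x) := (con 1 :+ e :* (x :* x)) :+
          (e :+ con 1) :* x) refl _ _ ⟩
    (1# + - 1# * (x * x)) + (- 1# + 1#) * x
      ≈⟨ +-cong (+-congˡ (*-congˡ (q^-+ n n ≡.refl))) (trans (*-congʳ (-‿inverseˡ 1#)) (zeroˡ x)) ⟩
    factor (- 1#) (n ℕ.+ n) + 0#
      ≈⟨ +-identityʳ _ ⟩
    factor (- 1#) (n ℕ.+ n) ∎
    where
    x = q ^ n

  E36-fuse : ∀ A → E36 1# A * E36 (- 1#) A ≈ P (A ℕ.+ A)
  E36-fuse A = begin
    E36 1# A * E36 (- 1#) A
      ≈⟨ prod-* (M ℕ.+ M) _ _ ⟨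
    prod (M ℕ.+ M) (λ i → factor 1# (A ℕ.+ 36 ℕ.* i) * factor (- 1#) (A ℕ.+ 36 ℕ.* i))
      ≈⟨ prod-cong (M ℕ.+ M) (λ i → trans (factor-fuse (A ℕ.+ 36 ℕ.* i))
          (reflexive (≡.cong (factor (- 1#)) (lemma A i)))) ⟩
    prod (M ℕ.+ M) (λ i → factor (- 1#) ((A ℕ.+ A) ℕ.+ 72 ℕ.* i))
      -- The fused product has 2M factors where `P` has M; those with i ≥ M are 1.
      ≈⟨ prod-extend (λ i M≤i → factor≈1 _ (ℕₚ.≤-trans M≤i
          (ℕₚ.≤-trans (ℕₚ.m≤n*m i 72) (ℕₚ.m≤n+m (72 ℕ.* i) (A ℕ.+ A))))) M ⟩
    P (A ℕ.+ A) ∎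
    where
    lemma : ∀ A i → (A ℕ.+ 36 ℕ.* i) ℕ.+ (A ℕ.+ 36 ℕ.* i) ≡ (A ℕ.+ A) ℕ.+ 72 ℕ.* i
    lemma = ℕ-Solver.solve-∀

  θ : Carrier → ℕ → Carrier
  θ ε A = theta ε A (36 ℕ.∸ A)

  θ-product : ∀ {ε} → Sign ε → ∀ {A} → 0 ℕ.< A → A ℕ.< 36 → θ ε A ≈ E36 ε (36 ℕ.∸ A) * (E36 ε A * J)
  θ-product {ε} ε² {A} lt lt′ = ≡.subst
    (λ s → θ ε A ≈ prod L (λ b → factor ε (36 ℕ.∸ A ℕ.+ s ℕ.* b)) * (prod L (λ a → factor ε (A ℕ.+ s ℕ.* a)) *
      prod L (λ i → factor (- 1#) (s ℕ.* suc i))))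
    (ℕₚ.m+[n∸m]≡n (ℕₚ.<⇒≤ lt′))
    (TripleProduct.triple-product ε² lt (ℕₚ.m<n⇒0<n∸m lt′) L ℕₚ.≤-refl)
    where
    L = M ℕ.+ M

  θ⁻-Π : ∀ {A} → 0 ℕ.< A → A ℕ.< 36 → θ (- 1#) A ≈ J * Π (residues± A)
  θ⁻-Π {A} lt lt′ = trans (θ-product Sign-−1 lt lt′) (trans
    (*-cong (E36-split (36 ℕ.∸ A)) (*-congʳ (E36-split A)))
    (solve 5 (λ a b c d j → (c :* d) :* ((a :* b) :* j) := j :* (a :* (b :* (c :* (d :* con 1))))) refl _ _ _ _
        _))

  θ⁺-Π : ∀ {A} → 0 ℕ.< A → A ℕ.< 36 → θ 1# A * Π (residues± A) ≈ J * Π (doubled± A)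
  θ⁺-Π {A} lt lt′ = begin
    θ 1# A * (P A * (P (A ℕ.+ 36) * (P B * (P (B ℕ.+ 36) * 1#))))
      ≈⟨ *-cong (θ-product Sign-1 lt lt′) (solve 4
          (λ a b c d → a :* (b :* (c :* (d :* con 1))) := (a :* b) :* (c :* d)) refl _ _ _ _) ⟩
    (E36 1# B * (E36 1# A * J)) * ((P A * P (A ℕ.+ 36)) * (P B * P (B ℕ.+ 36)))
      ≈⟨ *-congˡ (*-cong (E36-split A) (E36-split B)) ⟨
    (E36 1# B * (E36 1# A * J)) * (E36 (- 1#) A * E36 (- 1#) B)
      ≈⟨ solve 5 (λ b a j c d → (b :* (a :* j)) :* (c :* d) := j :* ((a :* c) :* ((b :* d) :* con 1))) refl _ _
          _ _ _ ⟩
    J * ((E36 1# A * E36 (- 1#) A) * ((E36 1# B * E36 (- 1#) B) * 1#))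
      ≈⟨ *-congˡ (*-cong (E36-fuse A) (*-congʳ (E36-fuse B))) ⟩
    J * (P (A ℕ.+ A) * (P (B ℕ.+ B) * 1#)) ∎
    where
    B = 36 ℕ.∸ A

  Θ : Carrier → List ℕ → Carrier
  Θ ε []      = 1#
  Θ ε (A ∷ l) = θ ε A * Θ ε l

  Θ⁻-Π : ∀ {l} → Admissible l → Θ (- 1#) l ≈ J ^ length l * Π (concatMap residues± l)
  Θ⁻-Π []                 = sym (*-identityˡ 1#)
  Θ⁻-Π {A ∷ l} ((a , b) ∷ ad) = trans (*-cong (θ⁻-Π a b) (Θ⁻-Π ad)) (trans
    (solve 4 (λ j x k y → (j :* x) :* (k :* y) := (j :* k) :* (x :* y)) refl _ _ _ _)
    (*-congˡ (sym (Π-++ (residues± A) (concatMap residues± l)))))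

  Θ⁺-Π : ∀ {l} → Admissible l → Θ 1# l * Π (concatMap residues± l) ≈ J ^ length l * Π (concatMap doubled± l)
  Θ⁺-Π []                 = refl
  Θ⁺-Π {A ∷ l} ((a , b) ∷ ad) = begin
    (θ 1# A * Θ 1# l) * Π (residues± A ++ concatMap residues± l)
      ≈⟨ *-congˡ (Π-++ (residues± A) (concatMap residues± l)) ⟩
    (θ 1# A * Θ 1# l) * (Π (residues± A) * Π (concatMap residues± l))
      ≈⟨ solve 4 (λ a b c d → (a :* b) :* (c :* d) := (a :* c) :* (b :* d)) refl _ _ _ _ ⟩
    (θ 1# A * Π (residues± A)) * (Θ 1# l * Π (concatMap residues± l))
      ≈⟨ *-cong (θ⁺-Π a b) (Θ⁺-Π ad) ⟩
    (J * Π (doubled± A)) * (J ^ length l * Π (concatMap doubled± l))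
      ≈⟨ solve 4 (λ j x k y → (j :* x) :* (k :* y) := (j :* k) :* (x :* y)) refl _ _ _ _ ⟩
    (J * J ^ length l) * (Π (doubled± A) * Π (concatMap doubled± l))
      ≈⟨ *-congˡ (Π-++ (doubled± A) (concatMap doubled± l)) ⟨
    J ^ suc (length l) * Π (doubled± A ++ concatMap doubled± l) ∎

  residues±-positive : ∀ {l} → Admissible l → All (0 ℕ.<_) (concatMap residues± l)
  residues±-positive []             = []
  residues±-positive {A ∷ l} ((a , b) ∷ ad) =
    a ∷ ℕₚ.<-≤-trans a (ℕₚ.m≤m+n A 36) ∷ ℕₚ.m<n⇒0<n∸m b ∷
    ℕₚ.<-≤-trans (ℕₚ.m<n⇒0<n∸m b) (ℕₚ.m≤m+n (36 ℕ.∸ A) 36) ∷ residues±-positive ad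

  Unit-Θ⁻ : ∀ {l} → Admissible l → Unit (Θ (- 1#) l)
  Unit-Θ⁻ {l} ad = Unit-cong (Θ⁻-Π ad) (Unit-* (Unit-^ (length l) Unit-J) (Unit-Π (residues±-positive ad)))

  -- Once the unit Π (residues± S) is multiplied in, both sides are products of factors `P`. The
  -- sorted lists match these factors, the inverse g removes Π L, and the equal lengths match the
  -- powers of `J`.
  theta-quotient : ∀ {g L C S} → Admissible C → Admissible S → length C ≡ length S → g * Π L ≈ 1# →
    sort (concatMap residues± C ++ concatMap residues± S) ≡ sort (L ++ concatMap doubled± S) →
    g * Θ (- 1#) C ≈ Θ 1# S
  theta-quotient {g} {L} {C} {S} adC adS len inv eq = Unit-cancel (Unit-Π (residues±-positive adS)) (begin
    Π S± * (g * Θ (- 1#) C)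
      ≈⟨ *-congˡ (*-congˡ (Θ⁻-Π adC)) ⟩
    Π S± * (g * (J ^ length C * Π C±))
      ≈⟨ solve 4 (λ s g j c → s :* (g :* (j :* c)) := g :* (j :* (c :* s))) refl _ _ _ _ ⟩
    g * (J ^ length C * (Π C± * Π S±))
      ≈⟨ *-congˡ (*-cong (^-congʳ J len) (trans (sym (Π-++ C± S±))
          (trans (Π-↭ (sort≡⇒↭ (C± ++ S±) (L ++ S₂) eq)) (Π-++ L S₂)))) ⟩
    g * (J ^ length S * (Π L * Π S₂))
      ≈⟨ solve 4 (λ g j l s → g :* (j :* (l :* s)) := (g :* l) :* (j :* s)) refl _ _ _ _ ⟩
    (g * Π L) * (J ^ length S * Π S₂)
      ≈⟨ trans (*-congʳ inv) (*-identityˡ _) ⟩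
    J ^ length S * Π S₂
      ≈⟨ Θ⁺-Π adS ⟨
    Θ 1# S * Π S±
      ≈⟨ *-comm _ _ ⟩
    Π S± * Θ 1# S ∎)
    where
    C± = concatMap residues± C
    S± = concatMap residues± S
    S₂ = concatMap doubled± S

-- The three-term relations

module ThreeTerm {r ℓ} (R : CommutativeRing r ℓ)
  (q : CommutativeRing.Carrier R) (M : ℕ) (q^M≈0 : PowerVanishes R q M) where

  open CommutativeRing R
  open RawSemiringDefinitions (Semiring.rawSemiring semiring) using (_^_)
  open Modulus72 R q M q^M≈0 public
  open import Relation.Binary.Reasoning.Setoid setoid
  open NaturalSolver commutativeSemiring

  g : ℕ → Carrier
  g n = theta 1# n (72 ℕ.∸ n)

  -- Used with A + B = 36. The last two theta functions are flipped so that, for numerals, all four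
  -- reduce to values of `g`.
  pair : ∀ {ε} → Sign ε → ∀ A F G .{{_ : NonZero A}} .{{_ : NonZero F}} .{{_ : NonZero G}} →
    let B = A ℕ.+ (F ℕ.+ G); C = A ℕ.+ G; D = A ℕ.+ F in
    theta ε A B * theta ε C D ≈
    theta 1# (A ℕ.+ C) (B ℕ.+ D) * theta 1# (A ℕ.+ D) (B ℕ.+ C) +
    ε * q ^ A * (theta 1# F ((A ℕ.+ B) ℕ.+ (A ℕ.+ C)) * theta 1# G ((A ℕ.+ B) ℕ.+ (A ℕ.+ D)))
  pair ε² A F G = trans
    (theta-product ε² A F G (ℕ.>-nonZero⁻¹ A) (ℕ.>-nonZero⁻¹ F) (ℕ.>-nonZero⁻¹ G))
    (+-congˡ (*-congˡ (*-cong
      (theta-sym 1# ((A ℕ.+ (A ℕ.+ (F ℕ.+ G))) ℕ.+ (A ℕ.+ (A ℕ.+ G))) F)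
      (theta-sym 1# ((A ℕ.+ (A ℕ.+ (F ℕ.+ G))) ℕ.+ (A ℕ.+ (A ℕ.+ F))) G))))

  pair⁺ = pair Sign-1
  pair⁻ = pair Sign-−1

  -- Minus one is treated as an indeterminate e. Its two properties enter by hand: 1 + e = 0 adds
  -- the moved terms to s, and e e = 1 turns the product of the two negative terms into a positive
  -- one.
  minus-product : ∀ {s t} μ P x R E y F →
    s + μ * (P * (y * F) + (x * R) * E) ≈ t + μ * (P * E + (x * R) * (y * F)) →
    s ≈ t + μ * ((P + - 1# * x * R) * (E + - 1# * y * F))
  minus-product {s} {t} μ P x R E y F eq = begin
    s
      ≈⟨ trans (+-congˡ (trans (*-congʳ (-‿inverseʳ 1#)) (zeroˡ _))) (+-identityʳ s) ⟨
    s + (1# + - 1#) * (μ * (P * (y * F) + (x * R) * E))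
      ≈⟨ solve 9 (λ s e μ P x R E y F → s :+ (con 1 :+ e) :* (μ :* (P :* (y :* F) :+ (x :* R) :* E)) :=
           (s :+ μ :* (P :* (y :* F) :+ (x :* R) :* E)) :+ e :* (μ :* (P :* (y :* F) :+ (x :* R) :* E))) refl _
               _ _ _ _ _ _ _ _ ⟩
    (s + μ * (P * (y * F) + (x * R) * E)) + - 1# * (μ * (P * (y * F) + (x * R) * E))
      ≈⟨ +-congʳ eq ⟩
    (t + μ * (P * E + (x * R) * (y * F))) + - 1# * (μ * (P * (y * F) + (x * R) * E))
      ≈⟨ +-congʳ (+-congˡ (*-congˡ (+-congˡ (sym (trans (*-congʳ Sign-−1) (*-identityˡ _)))))) ⟩
    (t + μ * (P * E + (- 1# * - 1#) * ((x * R) * (y * F)))) + - 1# * (μ * (P * (y * F) + (x * R) * E))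
      ≈⟨ solve 9 (λ t e μ P x R E y F → (t :+ μ :* (P :* E :+ (e :* e) :* ((x :* R) :* (y :* F)))) :+ e :*
          (μ :* (P :* (y :* F) :+ (x :* R) :* E)) :=
           t :+ μ :* ((P :+ e :* x :* R) :* (E :+ e :* y :* F))) refl _ _ _ _ _ _ _ _ _ ⟩
    t + μ * ((P + - 1# * x * R) * (E + - 1# * y * F)) ∎

  -- The last hypothesis is the three-term relation in terms of the right-hand sides of the others, with the
  -- negative terms moved across so that it is an identity in commutative semirings.
  three-term : ∀ a b {x₁ x₂ x₃ x₄ y₁ y₂ y₃ y₄ z₁ z₂ z₃ z₄ u v u′ v′ P x R E y F} →
    x₁ * x₂ ≈ u → x₃ * x₄ ≈ v → y₁ * y₂ ≈ u′ → y₃ * y₄ ≈ v′ →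
    z₁ * z₂ ≈ P + - 1# * x * R → z₃ * z₄ ≈ E + - 1# * y * F →
    u * v + q ^ b * (P * (y * F) + (x * R) * E) ≈ q ^ a * (u′ * v′) + q ^ b * (P * E + (x * R) * (y * F)) →
    x₁ * (x₂ * (x₃ * (x₄ * 1#))) ≈ q ^ a * (y₁ * (y₂ * (y₃ * (y₄ * 1#)))) + q ^ b *
        (z₁ * (z₂ * (z₃ * (z₄ * 1#))))
  three-term a b e₁ e₂ e₃ e₄ e₅ e₆ eq = trans (two-pairs e₁ e₂)
    (trans (minus-product _ _ _ _ _ _ _ eq)
      (+-cong (*-congˡ (sym (two-pairs e₃ e₄))) (*-congˡ (sym (two-pairs e₅ e₆)))))
    where
    two-pairs : ∀ {a b c d u v} → a * b ≈ u → c * d ≈ v → a * (b * (c * (d * 1#))) ≈ u * v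
    two-pairs e f = trans (solve 4 (λ a b c d → a :* (b :* (c :* (d :* con 1))) := (a :* b) :* (c :* d)) refl _
        _ _ _) (*-cong e f)

  three-termᵖ : ∀ {n} (q : Polynomial n) (a b : ℕ) →
    (A₁ : ℕ) (w₁ x₁ y₁ z₁ : Polynomial n) (A₂ : ℕ) (w₂ x₂ y₂ z₂ : Polynomial n)
    (A₃ : ℕ) (w₃ x₃ y₃ z₃ : Polynomial n) (A₄ : ℕ) (w₄ x₄ y₄ z₄ : Polynomial n)
    (A₅ : ℕ) (w₅ x₅ y₅ z₅ : Polynomial n) (A₆ : ℕ) (w₆ x₆ y₆ z₆ : Polynomial n) →
    Polynomial n × Polynomial n
  three-termᵖ q a b A₁ w₁ x₁ y₁ z₁ A₂ w₂ x₂ y₂ z₂ A₃ w₃ x₃ y₃ z₃ A₄ w₄ x₄ y₄ z₄ A₅ w₅ x₅ y₅ z₅ A₆ w₆ x₆ y₆ z₆ =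
    plus A₁ w₁ x₁ y₁ z₁ :* plus A₂ w₂ x₂ y₂ z₂ :+ q :^ b :*
        ((w₅ :* x₅) :* (q :^ A₆ :* (y₆ :* z₆)) :+ (q :^ A₅ :* (y₅ :* z₅)) :* (w₆ :* x₆))
    := q :^ a :* (plus A₃ w₃ x₃ y₃ z₃ :* plus A₄ w₄ x₄ y₄ z₄) :+ q :^ b :*
        ((w₅ :* x₅) :* (w₆ :* x₆) :+ (q :^ A₅ :* (y₅ :* z₅)) :* (q :^ A₆ :* (y₆ :* z₆)))
    where
    plus : ℕ → (w x y z : Polynomial _) → Polynomial _
    plus A w x y z = w :* x :+ con 1 :* q :^ A :* (y :* z)

  -- The four indices are 2, 6, 8, 18. For factors m and n the arguments of `pair⁺` and `pair⁻` are
  -- m, 36 - m - n, n - m; a row for the solver holds m and the indices m + n, 36 - n + m, 36 - m -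
  -- n, n - m of `g`.
  three-term₁ : Θ 1# (3 ∷ 5 ∷ 6 ∷ 12 ∷ []) ≈
    q ^ 1 * Θ 1# (2 ∷ 4 ∷ 5 ∷ 13 ∷ []) + q ^ 0 * Θ (- 1#) (1 ∷ 7 ∷ 8 ∷ 10 ∷ [])
  three-term₁ = three-term 1 0
    (pair⁺ 3 28 2) (pair⁺ 6 18 6)
    (pair⁺ 2 30 2) (pair⁺ 5 18 8)
    (pair⁻ 1 28 6) (pair⁻ 8 18 2)
    (solve 8 (λ q g2 g6 g8 g18 g28 g30 g34 → three-termᵖ q 1 0
      3 g8 g34 g28 g2 6 g18 g30 g18 g6
      2 g6 g34 g30 g2 5 g18 g28 g18 g8
      1 g8 g30 g28 g6 8 g18 g34 g18 g2)
      refl q (g 2) (g 6) (g 8) (g 18) (g 28) (g 30) (g 34))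

  -- The indices are 4, 6, 18, 26, with 14 read as 36 - 14 = 22.
  three-term₂ : Θ 1# (11 ∷ 15 ∷ 6 ∷ 12 ∷ []) ≈
    q ^ 0 * Θ 1# (7 ∷ 11 ∷ 10 ∷ 16 ∷ []) + q ^ 6 * Θ (- 1#) (1 ∷ 5 ∷ 4 ∷ 14 ∷ [])
  three-term₂ = three-term 0 6
    (pair⁺ 11 10 4) (pair⁺ 6 18 6)
    (pair⁺ 7 18 4) (pair⁺ 10 10 6)
    (pair⁻ 1 30 4) (pair⁻ 4 18 10)
    (solve 8 (λ q g4 g6 g10 g18 g26 g30 g32 → three-termᵖ q 0 6
      11 g26 g32 g10 g4 6 g18 g30 g18 g6
      7 g18 g32 g18 g4 10 g26 g30 g10 g6
      1 g6 g32 g30 g4 4 g18 g26 g18 g10)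
      refl q (g 4) (g 6) (g 10) (g 18) (g 26) (g 30) (g 32))

  -- The indices are 14, 16, 18, 30, with 14, 12 and 13 among the factors read as 22, 24 and 23.
  three-term₃ : Θ 1# (1 ∷ 17 ∷ 8 ∷ 14 ∷ []) ≈
    q ^ 1 * Θ 1# (1 ∷ 15 ∷ 6 ∷ 12 ∷ []) + q ^ 0 * Θ (- 1#) (7 ∷ 13 ∷ 2 ∷ 16 ∷ [])
  three-term₃ = three-term 1 0
    (pair⁺ 1 18 16) (pair⁺ 8 14 6)
    (pair⁺ 1 20 14) (pair⁺ 6 18 6)
    (pair⁻ 7 16 6) (pair⁻ 2 18 14)
    (solve 8 (λ q g6 g14 g16 g18 g20 g22 g30 → three-termᵖ q 1 0
      1 g18 g20 g18 g16 8 g22 g30 g14 g6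
      1 g16 g22 g20 g14 6 g18 g30 g18 g6
      7 g20 g30 g16 g6 2 g18 g22 g18 g14)
      refl q (g 6) (g 14) (g 16) (g 18) (g 20) (g 22) (g 30))

  -- The indices are 6, 16, 18, 22, with 16 and the 17 next to 3 read as 20 and 19.
  three-term₄ : Θ 1# (8 ∷ 14 ∷ 1 ∷ 17 ∷ []) ≈
    q ^ 0 * Θ 1# (6 ∷ 12 ∷ 3 ∷ 17 ∷ []) + q ^ 1 * Θ (- 1#) (5 ∷ 11 ∷ 2 ∷ 16 ∷ [])
  three-term₄ = three-term 0 1
    (pair⁺ 8 14 6) (pair⁺ 1 18 16)
    (pair⁺ 6 18 6) (pair⁺ 3 16 14)
    (pair⁻ 5 20 6) (pair⁻ 2 18 14)
    (solve 8 (λ q g6 g14 g16 g18 g20 g22 g30 → three-termᵖ q 0 1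
      8 g22 g30 g14 g6 1 g18 g20 g18 g16
      6 g18 g30 g18 g6 3 g20 g22 g16 g14
      5 g16 g30 g20 g6 2 g18 g22 g18 g14)
      refl q (g 6) (g 14) (g 16) (g 18) (g 20) (g 22) (g 30))

  -- The indices are 4, 10, 18, 30, with 16 and 12 read as 20 and 24.
  three-term₅ : Θ 1# (7 ∷ 11 ∷ 10 ∷ 16 ∷ []) ≈
    q ^ 4 * Θ 1# (3 ∷ 7 ∷ 6 ∷ 12 ∷ []) + q ^ 0 * Θ (- 1#) (13 ∷ 17 ∷ 4 ∷ 14 ∷ [])
  three-term₅ = three-term 4 0
    (pair⁺ 7 18 4) (pair⁺ 10 10 6)
    (pair⁺ 3 26 4) (pair⁺ 6 18 6)
    (pair⁻ 13 6 4) (pair⁻ 4 18 10)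
    (solve 8 (λ q g4 g6 g10 g18 g26 g30 g32 → three-termᵖ q 4 0
      7 g18 g32 g18 g4 10 g26 g30 g10 g6
      3 g10 g32 g26 g4 6 g18 g30 g18 g6
      13 g30 g32 g6 g4 4 g18 g26 g18 g10)
      refl q (g 4) (g 6) (g 10) (g 18) (g 26) (g 30) (g 32))

  -- The indices are 2, 6, 18, 28, with the 13 next to 5 read as 23.
  three-term₆ : Θ 1# (13 ∷ 15 ∷ 6 ∷ 12 ∷ []) ≈
    q ^ 6 * Θ 1# (2 ∷ 4 ∷ 5 ∷ 13 ∷ []) + q ^ 0 * Θ (- 1#) (8 ∷ 10 ∷ 11 ∷ 17 ∷ [])
  three-term₆ = three-term 6 0
    (pair⁺ 13 8 2) (pair⁺ 6 18 6)
    (pair⁺ 2 30 2) (pair⁺ 5 18 8)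
    (pair⁻ 8 18 2) (pair⁻ 11 8 6)
    (solve 8 (λ q g2 g6 g8 g18 g28 g30 g34 → three-termᵖ q 6 0
      13 g28 g34 g8 g2 6 g18 g30 g18 g6
      2 g6 g34 g30 g2 5 g18 g28 g18 g8
      8 g18 g34 g18 g2 11 g28 g30 g8 g6)
      refl q (g 2) (g 6) (g 8) (g 18) (g 28) (g 30) (g 34))

-- Power series and partitions

Series : Set
Series = ℕ → ℤ

infixl 7 _⊛_
_⊛_ : Series → Series → Series
(f ⊛ g) zero    = f 0 ℤ.* g 0
(f ⊛ g) (suc n) = f 0 ℤ.* g (suc n) ℤ.+ ((λ k → f (suc k)) ⊛ g) n

1ₛ : Series
1ₛ zero    = 1ℤ
1ₛ (suc n) = 0ℤ

X : Series
X zero    = 0ℤ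
X (suc n) = 1ₛ n

-- A coefficient of a product depends only on coefficients of at most the same degree; this makes
-- multiplication respect truncated equality.
⊛-cong-≤ : ∀ n {f f′ g g′} → (∀ k → k ℕ.≤ n → f k ≡ f′ k) → (∀ k → k ℕ.≤ n → g k ≡ g′ k) → (f ⊛ g) n ≡
    (f′ ⊛ g′) n
⊛-cong-≤ zero    e d = ≡.cong₂ ℤ._*_ (e 0 z≤n) (d 0 z≤n)
⊛-cong-≤ (suc n) e d = ≡.cong₂ ℤ._+_ (≡.cong₂ ℤ._*_ (e 0 z≤n) (d (suc n) ℕₚ.≤-refl))
  (⊛-cong-≤ n (λ k k≤n → e (suc k) (s≤s k≤n)) (λ k k≤n → d k (ℕₚ.≤-trans k≤n (ℕₚ.n≤1+n n))))

⊛-congˡ : ∀ f {g g′} → (∀ k → g k ≡ g′ k) → ∀ n → (f ⊛ g) n ≡ (f ⊛ g′) n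
⊛-congˡ f e n = ⊛-cong-≤ n {f} (λ _ _ → ≡.refl) (λ k _ → e k)

⊛-distribʳ : ∀ h f g n → ((λ k → f k ℤ.+ g k) ⊛ h) n ≡ (f ⊛ h) n ℤ.+ (g ⊛ h) n
⊛-distribʳ h f g zero    = ℤₚ.*-distribʳ-+ (h 0) (f 0) (g 0)
⊛-distribʳ h f g (suc n) = ≡.trans (≡.cong (λ z → (f 0 ℤ.+ g 0) ℤ.* h (suc n) ℤ.+ z)
    (⊛-distribʳ h (λ k → f (suc k)) (λ k → g (suc k)) n))
  (lemma (f 0) (g 0) (h (suc n)) _ _)
  where
  lemma : ∀ a b c x y → (a ℤ.+ b) ℤ.* c ℤ.+ (x ℤ.+ y) ≡ (a ℤ.* c ℤ.+ x) ℤ.+ (b ℤ.* c ℤ.+ y)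
  lemma = ℤ-Solver.solve-∀

⊛-scale : ∀ c f g n → ((λ k → c ℤ.* f k) ⊛ g) n ≡ c ℤ.* (f ⊛ g) n
⊛-scale c f g zero    = ℤₚ.*-assoc c (f 0) (g 0)
⊛-scale c f g (suc n) = ≡.trans (≡.cong (λ z → c ℤ.* f 0 ℤ.* g (suc n) ℤ.+ z) (⊛-scale c (λ k → f (suc k)) g n))
    (lemma c (f 0) (g (suc n)) _)
  where
  lemma : ∀ c a b x → c ℤ.* a ℤ.* b ℤ.+ c ℤ.* x ≡ c ℤ.* (a ℤ.* b ℤ.+ x)
  lemma = ℤ-Solver.solve-∀

⊛-assoc : ∀ f g h n → ((f ⊛ g) ⊛ h) n ≡ (f ⊛ (g ⊛ h)) n
⊛-assoc f g h zero    = ℤₚ.*-assoc (f 0) (g 0) (h 0)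
⊛-assoc f g h (suc n) = begin
  f 0 ℤ.* g 0 ℤ.* h (suc n) ℤ.+ ((λ k → f 0 ℤ.* g (suc k) ℤ.+ ((λ k → f (suc k)) ⊛ g) k) ⊛ h) n
    ≡⟨ ≡.cong (λ z → f 0 ℤ.* g 0 ℤ.* h (suc n) ℤ.+ z) (≡.trans (⊛-distribʳ h _ _ n)
        (≡.cong₂ ℤ._+_ (⊛-scale (f 0) (λ k → g (suc k)) h n) (⊛-assoc (λ k → f (suc k)) g h n))) ⟩
  f 0 ℤ.* g 0 ℤ.* h (suc n) ℤ.+ (f 0 ℤ.* ((λ k → g (suc k)) ⊛ h) n ℤ.+ ((λ k → f (suc k)) ⊛ (g ⊛ h)) n)
    ≡⟨ lemma (f 0) (g 0) (h (suc n)) _ _ ⟩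
  f 0 ℤ.* (g ⊛ h) (suc n) ℤ.+ ((λ k → f (suc k)) ⊛ (g ⊛ h)) n ∎
  where
  open ≡.≡-Reasoning
  lemma : ∀ a b c x y → a ℤ.* b ℤ.* c ℤ.+ (a ℤ.* x ℤ.+ y) ≡ a ℤ.* (b ℤ.* c ℤ.+ x) ℤ.+ y
  lemma = ℤ-Solver.solve-∀

-- The mirror image of the defining recursion, peeling off g instead of f; commutativity follows
-- from it by induction.
⊛-last : ∀ f g n → (f ⊛ g) (suc n) ≡ (f ⊛ (λ k → g (suc k))) n ℤ.+ f (suc n) ℤ.* g 0
⊛-last f g zero    = ≡.refl
⊛-last f g (suc n) = ≡.trans (≡.cong (λ z → f 0 ℤ.* g (suc (suc n)) ℤ.+ z) (⊛-last (λ k → f (suc k)) g n))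
  (≡.sym (ℤₚ.+-assoc (f 0 ℤ.* g (suc (suc n))) _ _))

⊛-comm : ∀ f g n → (f ⊛ g) n ≡ (g ⊛ f) n
⊛-comm f g zero    = ℤₚ.*-comm (f 0) (g 0)
⊛-comm f g (suc n) = begin
  f 0 ℤ.* g (suc n) ℤ.+ ((λ k → f (suc k)) ⊛ g) n
    ≡⟨ ≡.cong₂ ℤ._+_ (ℤₚ.*-comm (f 0) (g (suc n))) (⊛-comm (λ k → f (suc k)) g n) ⟩
  g (suc n) ℤ.* f 0 ℤ.+ (g ⊛ (λ k → f (suc k))) n
    ≡⟨ ℤₚ.+-comm (g (suc n) ℤ.* f 0) _ ⟩
  (g ⊛ (λ k → f (suc k))) n ℤ.+ g (suc n) ℤ.* f 0
    ≡⟨ ⊛-last g f n ⟨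
  (g ⊛ f) (suc n) ∎
  where open ≡.≡-Reasoning

⊛-zeroˡ : ∀ g n → ((λ _ → 0ℤ) ⊛ g) n ≡ 0ℤ
⊛-zeroˡ g zero    = ≡.refl
⊛-zeroˡ g (suc n) = ≡.trans (ℤₚ.+-identityˡ _) (⊛-zeroˡ g n)

⊛-identityˡ : ∀ g n → (1ₛ ⊛ g) n ≡ g n
⊛-identityˡ g zero    = ℤₚ.*-identityˡ (g 0)
⊛-identityˡ g (suc n) = ≡.trans (≡.cong₂ ℤ._+_ (ℤₚ.*-identityˡ (g (suc n))) (⊛-zeroˡ g n)) (ℤₚ.+-identityʳ _)

-- ℤ[[q]] modulo q^M, with truncation expressed by the equality.
truncated : ℕ → CommutativeRing _ _
truncated M = record
  { Carrier = Series
  ; _≈_ = λ f g → ∀ n → n ℕ.< M → f n ≡ g n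
  ; _+_ = λ f g n → f n ℤ.+ g n
  ; _*_ = _⊛_
  ; -_ = λ f n → ℤ.- f n
  ; 0# = λ _ → 0ℤ
  ; 1# = 1ₛ
  ; isCommutativeRing = record
    { isRing = record
      { +-isAbelianGroup = record
        { isGroup = record
          { isMonoid = record
            { isSemigroup = record
              { isMagma = record
                { isEquivalence = record
                  { refl = λ _ _ → ≡.refl
                  ; sym = λ e n n<M → ≡.sym (e n n<M)
                  ; trans = λ e d n n<M → ≡.trans (e n n<M) (d n n<M)
                  }
                ; ∙-cong = λ e d n n<M → ≡.cong₂ ℤ._+_ (e n n<M) (d n n<M)
                }
              ; assoc = λ f g h n _ → ℤₚ.+-assoc (f n) (g n) (h n)
              }
            ; identity = (λ f n _ → ℤₚ.+-identityˡ (f n)) , (λ f n _ → ℤₚ.+-identityʳ (f n))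
            }
          ; inverse = (λ f n _ → ℤₚ.+-inverseˡ (f n)) , (λ f n _ → ℤₚ.+-inverseʳ (f n))
          ; ⁻¹-cong = λ e n n<M → ≡.cong ℤ.-_ (e n n<M)
          }
        ; comm = λ f g n _ → ℤₚ.+-comm (f n) (g n)
        }
      ; *-cong = λ e d n n<M → ⊛-cong-≤ n
          (λ k k≤n → e k (ℕₚ.≤-<-trans k≤n n<M)) (λ k k≤n → d k (ℕₚ.≤-<-trans k≤n n<M))
      ; *-assoc = λ f g h n _ → ⊛-assoc f g h n
      ; *-identity = (λ f n _ → ⊛-identityˡ f n) , (λ f n _ → ≡.trans (⊛-comm f 1ₛ n) (⊛-identityˡ f n))
      ; distrib = (λ f g h n _ → ≡.trans (⊛-comm f _ n) (≡.trans (⊛-distribʳ f g h n)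
            (≡.cong₂ ℤ._+_ (⊛-comm g f n) (⊛-comm h f n))))
          , (λ f g h n _ → ⊛-distribʳ f g h n)
      }
    ; *-comm = λ f g n _ → ⊛-comm f g n
    }
  }

-- Powers of X that do not depend on M, so that their coefficients are found without truncation;
-- `X^≡` identifies them with the powers in `truncated M`.
X^_ : ℕ → Series
X^ zero  = 1ₛ
X^ suc k = X ⊛ (X^ k)

X-⊛-suc : ∀ g n → (X ⊛ g) (suc n) ≡ g n
X-⊛-suc g n = ≡.trans (ℤₚ.+-identityˡ _) (⊛-identityˡ g n)

X^-coefficient : ∀ k n → n ≢ k → (X^ k) n ≡ 0ℤ
X^-coefficient zero    zero    n≢k = contradiction ≡.refl n≢k
X^-coefficient zero    (suc n) n≢k = ≡.refl
X^-coefficient (suc k) zero    n≢k = ≡.refl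
X^-coefficient (suc k) (suc n) n≢k = ≡.trans (X-⊛-suc (X^ k) n) (X^-coefficient k n (λ e → n≢k (≡.cong suc e)))

X^-⊛-+ : ∀ k g n → ((X^ k) ⊛ g) (k ℕ.+ n) ≡ g n
X^-⊛-+ zero    g n = ⊛-identityˡ g n
X^-⊛-+ (suc k) g n = ≡.trans (⊛-assoc X (X^ k) g (suc (k ℕ.+ n)))
  (≡.trans (X-⊛-suc ((X^ k) ⊛ g) (k ℕ.+ n)) (X^-⊛-+ k g n))

X^-⊛-< : ∀ k g n → n ℕ.< k → ((X^ k) ⊛ g) n ≡ 0ℤ
X^-⊛-< (suc k) g zero    _         = ≡.refl
X^-⊛-< (suc k) g (suc n) (s≤s n<k) = ≡.trans (⊛-assoc X (X^ k) g (suc n))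
  (≡.trans (X-⊛-suc ((X^ k) ⊛ g) n) (X^-⊛-< k g n n<k))

-- Recurrences for partition counts with bounded parts

summand : PartSet → ℕ → ℕ → ℕ → ℕ
summand S m n j = if (j ℕ.* suc m) ≤ᵇ n then pLe S m (n ℕ.∸ (j ℕ.* suc m)) else 0

multiplicitySum : PartSet → ℕ → ℕ → ℕ → ℕ
multiplicitySum S m n zero    = pLe S m n
multiplicitySum S m n (suc j) = multiplicitySum S m n j ℕ.+ summand S m n (suc j)

-- The local function of pLe cannot be named here, so the left-hand side of the second
-- statement is left to be inferred from the first.
mutual
  pLe-part : ∀ S m n → S (suc m) ≡ true → pLe S (suc m) n ≡ multiplicitySum S m n n
  pLe-part S m zero    e rewrite e = ≡.refl
  pLe-part S m (suc k) e rewrite e with suc k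
  -- The total is abstracted to n, so that it and the running multiplicity k are independent
  -- variables in the inferred left-hand side.
  ... | n = ≡.cong (ℕ._+ (if m ℕ.+ k ℕ.* suc m <ᵇ n then pLe S m (k ℕ.∸ (m ℕ.+ k ℕ.* suc m)) else 0))
    (pLe-local S m n k)

  pLe-local : ∀ S m n k → _ ≡ multiplicitySum S m n k
  pLe-local S m n zero    = ≡.refl
  pLe-local S m n (suc k) = ≡.cong (ℕ._+ summand S m n (suc k)) (pLe-local S m n k)

pLe-nonpart : ∀ S m n → S (suc m) ≡ false → pLe S (suc m) n ≡ pLe S m n
pLe-nonpart S m n e rewrite e = ≡.refl

summand-≤ : ∀ S m n j → j ℕ.* suc m ℕ.≤ n → summand S m n j ≡ pLe S m (n ℕ.∸ j ℕ.* suc m)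
summand-≤ S m n j le with j ℕ.* suc m ≤ᵇ n | ℕₚ.≤⇒≤ᵇ le
... | true | _ = ≡.refl

summand-> : ∀ S m n j → n ℕ.< j ℕ.* suc m → summand S m n j ≡ 0
summand-> S m n j lt with j ℕ.* suc m ≤ᵇ n | ℕₚ.≤ᵇ⇒≤ (j ℕ.* suc m) n
... | false | _ = ≡.refl
... | true  | f = contradiction (f tt) (ℕₚ.<⇒≱ lt)

multiplicitySum-< : ∀ S m n j → n ℕ.< suc m → multiplicitySum S m n j ≡ pLe S m n
multiplicitySum-< S m n zero    lt = ≡.refl
multiplicitySum-< S m n (suc j) lt = ≡.trans
  (≡.cong₂ ℕ._+_ (multiplicitySum-< S m n j lt)
      (summand-> S m n (suc j) (ℕₚ.<-≤-trans lt (ℕₚ.m≤m+n (suc m) _))))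
  (ℕₚ.+-identityʳ _)

multiplicitySum-extend : ∀ S m n d → multiplicitySum S m n (d ℕ.+ n) ≡ multiplicitySum S m n n
multiplicitySum-extend S m n zero    = ≡.refl
multiplicitySum-extend S m n (suc d) = ≡.trans
  (≡.cong₂ ℕ._+_ (multiplicitySum-extend S m n d)
    (summand-> S m n (suc (d ℕ.+ n)) (ℕₚ.<-≤-trans (s≤s (ℕₚ.m≤n+m n d)) (ℕₚ.m≤m*n (suc (d ℕ.+ n)) (suc m)))))
  (ℕₚ.+-identityʳ _)

summand-suc : ∀ S m n j → summand S m (suc m ℕ.+ n) (suc j) ≡ summand S m n j
summand-suc S m n j with j ℕ.* suc m ℕ.≤? n
... | yes le = ≡.trans (summand-≤ S m (suc m ℕ.+ n) (suc j) (ℕₚ.+-monoʳ-≤ (suc m) le))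
  (≡.trans (≡.cong (pLe S m) (ℕₚ.[m+n]∸[m+o]≡n∸o (suc m) n (j ℕ.* suc m))) (≡.sym (summand-≤ S m n j le)))
... | no  gt = ≡.trans (summand-> S m (suc m ℕ.+ n) (suc j) (ℕₚ.+-monoʳ-< (suc m) (ℕₚ.≰⇒> gt)))
  (≡.sym (summand-> S m n j (ℕₚ.≰⇒> gt)))

multiplicitySum-suc : ∀ S m n j →
  multiplicitySum S m (suc m ℕ.+ n) (suc j) ≡ pLe S m (suc m ℕ.+ n) ℕ.+ multiplicitySum S m n j
multiplicitySum-suc S m n zero    = ≡.cong (pLe S m (suc m ℕ.+ n) ℕ.+_) (summand-suc S m n 0)
multiplicitySum-suc S m n (suc j) = ≡.trans
  (≡.cong₂ ℕ._+_ (multiplicitySum-suc S m n j) (summand-suc S m n (suc j)))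
  (ℕₚ.+-assoc (pLe S m (suc m ℕ.+ n)) _ _)

pLe-part-< : ∀ S m n → S (suc m) ≡ true → n ℕ.< suc m → pLe S (suc m) n ≡ pLe S m n
pLe-part-< S m n e lt = ≡.trans (pLe-part S m n e) (multiplicitySum-< S m n n lt)

pLe-part-+ : ∀ S m n → S (suc m) ≡ true →
  pLe S (suc m) (suc m ℕ.+ n) ≡ pLe S m (suc m ℕ.+ n) ℕ.+ pLe S (suc m) n
pLe-part-+ S m n e = ≡.trans (pLe-part S m (suc m ℕ.+ n) e)
  -- Taking out one copy of the part m + 1 leaves multiplicities up to m + n; those above n
  -- contribute 0.
  (≡.trans (multiplicitySum-suc S m n (m ℕ.+ n))
  (≡.cong (pLe S m (suc m ℕ.+ n) ℕ.+_) (≡.trans (multiplicitySum-extend S m n m) (≡.sym (pLe-part S m n e)))))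

pLe-< : ∀ S m n → n ℕ.< suc m → pLe S (suc m) n ≡ pLe S m n
pLe-< S m n lt = cases (S (suc m)) ≡.refl
  where
  cases : ∀ b → S (suc m) ≡ b → pLe S (suc m) n ≡ pLe S m n
  cases true  e = pLe-part-< S m n e lt
  cases false e = pLe-nonpart S m n e

pLe-stable : ∀ S {m n} → n ℕ.≤′ m → pLe S m n ≡ p S n
pLe-stable S ℕ.≤′-refl                   = ≡.refl
pLe-stable S {suc m} {n} (ℕ.≤′-step le) = ≡.trans (pLe-< S m n (s≤s (ℕₚ.≤′⇒≤ le))) (pLe-stable S le)

-- Partition generating functions as inverses of products over residues mod 72

admissible? : Decidable Admissible
admissible? = All.all? (λ A → (0 ℕ.<? A) ×-dec (A ℕ.<? 36))

parts : PartSet → ℕ → List ℕ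
parts S zero    = []
parts S (suc d) = if S (suc d) then suc d ∷ parts S d else parts S d

Periodic : PartSet → Set
Periodic S = ∀ r i → S (r ℕ.+ i ℕ.* 72) ≡ S r

pmMod-periodic : ∀ rs → Periodic (pmMod 72 rs)
pmMod-periodic rs r i = ≡.cong
  (λ z → any (λ r → (z ≡ᵇ (r % 72)) ∨ (z ≡ᵇ ((72 ℕ.∸ (r % 72)) % 72))) rs) (DivMod.[m+kn]%n≡m%n r i 72)

module PartitionProduct {r ℓ} (R : CommutativeRing r ℓ)
  (q : CommutativeRing.Carrier R) (M : ℕ) (q^M≈0 : PowerVanishes R q M) where

  open CommutativeRing R
  open RawSemiringDefinitions (Semiring.rawSemiring semiring) using (_^_)
  open ThreeTerm R q M q^M≈0 public
  open import Relation.Binary.Reasoning.Setoid setoid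
  open NaturalSolver commutativeSemiring

  factor-inverse : ∀ {G H} n → G ≈ H + q ^ n * G → G * factor (- 1#) n ≈ H
  factor-inverse {G} {H} n eq = begin
    G * (1# + - 1# * x)
      ≈⟨ solve 3 (λ G x e → G :* (con 1 :+ e :* x) := G :+ e :* (x :* G)) refl _ _ _ ⟩
    G + - 1# * (x * G)
      ≈⟨ +-congʳ eq ⟩
    (H + x * G) + - 1# * (x * G)
      ≈⟨ solve 4 (λ H x G e → (H :+ x :* G) :+ e :* (x :* G) := H :+ (e :+ con 1) :* (x :* G)) refl _ _ _ _ ⟩
    H + (- 1# + 1#) * (x * G)
      ≈⟨ +-congˡ (trans (*-congʳ (-‿inverseˡ 1#)) (zeroˡ _)) ⟩
    H + 0#
      ≈⟨ +-identityʳ H ⟩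
    H ∎
    where
    x = q ^ n

  select : Bool → Carrier → Carrier
  select b x = if b then x else 1#

  prod-swap : ∀ m n (h : ℕ → ℕ → Carrier) → prod m (λ i → prod n (h i)) ≈ prod n (λ j → prod m (λ i → h i j))
  prod-swap zero    n h = sym (prod-one n (λ _ → refl))
  prod-swap (suc m) n h = trans (*-congʳ (prod-swap m n h)) (sym (prod-* n _ _))

  prod-blocks : ∀ m d f → prod (m ℕ.* d) f ≈ prod m (λ i → prod d (λ j → f (i ℕ.* d ℕ.+ j)))
  prod-blocks zero    d f = refl
  prod-blocks (suc m) d f = trans (prod-append d (m ℕ.* d) f) (*-congʳ (prod-blocks m d f))

  prod-select : ∀ m b f → prod m (λ i → select b (f i)) ≈ select b (prod m f)
  prod-select m true  f = refl
  prod-select m false f = prod-one m (λ _ → refl)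

  Π-parts : ∀ S d → prod d (λ j → select (S (suc j)) (P (suc j))) ≈ Π (parts S d)
  Π-parts S zero    = refl
  Π-parts S (suc d) = trans (*-congʳ (Π-parts S d)) (cases (S (suc d)))
    where
    cases : ∀ b → Π (parts S d) * select b (P (suc d)) ≈ Π (if b then suc d ∷ parts S d else parts S d)
    cases true  = *-comm _ _
    cases false = *-identityʳ _

  -- The first 72 M integers form M blocks of length 72. Exchanging the two products collects, for
  -- each residue, exactly the M factors of `P`.
  prod-periodic : ∀ S → Periodic S →
    prod (M ℕ.* 72) (λ k → select (S (suc k)) (factor (- 1#) (suc k))) ≈ Π (parts S 72)
  prod-periodic S periodic = begin
    prod (M ℕ.* 72) (λ k → select (S (suc k)) (factor (- 1#) (suc k)))
      ≈⟨ prod-blocks M 72 _ ⟩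
    prod M (λ i → prod 72 (λ j → select (S (suc (i ℕ.* 72 ℕ.+ j))) (factor (- 1#) (suc (i ℕ.* 72 ℕ.+ j)))))
      ≈⟨ prod-swap M 72 (λ i j → select (S (suc (i ℕ.* 72 ℕ.+ j))) (factor (- 1#) (suc (i ℕ.* 72 ℕ.+ j)))) ⟩
    prod 72 (λ j → prod M (λ i → select (S (suc (i ℕ.* 72 ℕ.+ j))) (factor (- 1#) (suc (i ℕ.* 72 ℕ.+ j)))))
      ≈⟨ prod-cong 72 (λ j → trans (prod-cong M (λ i → reflexive (≡.cong₂ (λ b n → select b (factor (- 1#) n))
            (≡.trans (≡.cong S (≡.cong suc (ℕₚ.+-comm (i ℕ.* 72) j))) (periodic (suc j) i))
            (≡.cong suc (≡.trans (ℕₚ.+-comm (i ℕ.* 72) j) (≡.cong (j ℕ.+_) (ℕₚ.*-comm i 72)))))))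
          (prod-select M (S (suc j)) (λ i → factor (- 1#) (suc j ℕ.+ 72 ℕ.* i)))) ⟩
    prod 72 (λ j → select (S (suc j)) (P (suc j)))
      ≈⟨ Π-parts S 72 ⟩
    Π (parts S 72) ∎

  -- The recurrence says that multiplication by 1 - q^(m+1) takes G (m + 1) to G m when m + 1 is a
  -- part, so the whole product telescopes down to G 0.
  Π-parts-inverse : ∀ S → Periodic S → (G : ℕ → Carrier) → G 0 ≈ 1# →
    (∀ m → S (suc m) ≡ true → G (suc m) ≈ G m + q ^ suc m * G (suc m)) →
    (∀ m → S (suc m) ≡ false → G (suc m) ≈ G m) →
    G (M ℕ.* 72) * Π (parts S 72) ≈ 1#
  Π-parts-inverse S periodic G G₀ part nonpart = trans (*-congˡ (sym (prod-periodic S periodic)))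
      (inverse (M ℕ.* 72))
    where
    step : ∀ m b → S (suc m) ≡ b → G (suc m) * select b (factor (- 1#) (suc m)) ≈ G m
    step m true  e = factor-inverse (suc m) (part m e)
    step m false e = trans (*-identityʳ _) (nonpart m e)
    inverse : ∀ m → G m * prod m (λ k → select (S (suc k)) (factor (- 1#) (suc k))) ≈ 1#
    inverse zero    = trans (*-identityʳ _) G₀
    inverse (suc m) = trans
      (solve 3 (λ a b c → a :* (b :* c) := (a :* c) :* b) refl _ _ _)
      (trans (*-congʳ (step m (S (suc m)) ≡.refl)) (inverse m))

  -- Dividing the three-term relation by the unit Θ (- 1#) C turns its last term into the bare
  -- monomial q^b, the only discrepancy between the two generating functions.
  quotient-identity : ∀ {g h L K C S T} a b → Admissible C → Admissible S → Admissible T →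
    length C ≡ length S → length C ≡ length T → g * Π L ≈ 1# → h * Π K ≈ 1# →
    sort (concatMap residues± C ++ concatMap residues± S) ≡ sort (L ++ concatMap doubled± S) →
    sort (concatMap residues± C ++ concatMap residues± T) ≡ sort (K ++ concatMap doubled± T) →
    Θ 1# S ≈ q ^ a * Θ 1# T + q ^ b * Θ (- 1#) C →
    g ≈ q ^ a * h + q ^ b
  quotient-identity {g} {h} {L} {K} {C} {S} {T} a b adC adS adT lenS lenT invL invK eqL eqK eq =
    Unit-cancel (Unit-Θ⁻ adC) (begin
      Θ (- 1#) C * g
        ≈⟨ *-comm _ _ ⟩
      g * Θ (- 1#) C
        ≈⟨ theta-quotient {L = L} adC adS lenS invL eqL ⟩
      Θ 1# S
        ≈⟨ eq ⟩
      q ^ a * Θ 1# T + q ^ b * Θ (- 1#) C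
        ≈⟨ +-congʳ (*-congˡ (theta-quotient {L = K} adC adT lenT invK eqK)) ⟨
      q ^ a * (h * Θ (- 1#) C) + q ^ b * Θ (- 1#) C
        ≈⟨ solve 4 (λ x h t y → x :* (h :* t) :+ y :* t := t :* (x :* h :+ y)) refl _ _ _ _ ⟩
      Θ (- 1#) C * (q ^ a * h + q ^ b) ∎)

module GeneratingFunction (M : ℕ) where
  open CommutativeRing (truncated M)
  open RawSemiringDefinitions (Semiring.rawSemiring semiring) using (_^_)

  X^≡ : ∀ k n → (X ^ k) n ≡ (X^ k) n
  X^≡ zero    n = ≡.refl
  X^≡ (suc k) n = ⊛-congˡ X (X^≡ k) n

  X^M≈0 : X ^ M ≈ 0#
  X^M≈0 n n<M = ≡.trans (X^≡ M n) (X^-coefficient M n (ℕₚ.<⇒≢ n<M))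

  open PartitionProduct (truncated M) X M X^M≈0 public

  genLe : PartSet → ℕ → Series
  genLe S m n = + pLe S m n

  gen : PartSet → Series
  gen S n = + p S n

  genLe-0 : ∀ S → genLe S 0 ≈ 1#
  genLe-0 S zero    _ = ≡.refl
  genLe-0 S (suc n) _ = ≡.refl

  genLe-recurrence : ∀ S m → S (suc m) ≡ true → genLe S (suc m) ≈ genLe S m + X ^ suc m * genLe S (suc m)
  genLe-recurrence S m e n _ = ≡.trans (split n)
    (≡.cong (λ z → genLe S m n ℤ.+ z) (⊛-cong-≤ n {g = genLe S (suc m)} (λ k _ → ≡.sym (X^≡ (suc m) k))
        (λ _ _ → ≡.refl)))
    where
    split : ∀ n → genLe S (suc m) n ≡ genLe S m n ℤ.+ ((X^ suc m) ⊛ genLe S (suc m)) n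
    split n with n ℕ.<? suc m
    ... | yes lt = ≡.trans (≡.cong +_ (pLe-part-< S m n e lt))
      (≡.sym (≡.trans (≡.cong (λ z → genLe S m n ℤ.+ z) (X^-⊛-< (suc m) (genLe S (suc m)) n lt))
          (ℤₚ.+-identityʳ _)))
    ... | no ≥ = ≡.subst (λ n → genLe S (suc m) n ≡ genLe S m n ℤ.+ ((X^ suc m) ⊛ genLe S (suc m)) n)
      (ℕₚ.m+[n∸m]≡n (ℕₚ.≮⇒≥ ≥))
      (≡.trans (≡.cong +_ (pLe-part-+ S m (n ℕ.∸ suc m) e))
        (≡.cong (λ z → genLe S m (suc m ℕ.+ (n ℕ.∸ suc m)) ℤ.+ z)
          (≡.sym (X^-⊛-+ (suc m) (genLe S (suc m)) (n ℕ.∸ suc m)))))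

  gen-inverse : ∀ S → Periodic S → gen S * Π (parts S 72) ≈ 1#
  gen-inverse S periodic = trans {gen S * Π (parts S 72)} {genLe S (M ℕ.* 72) * Π (parts S 72)} {1#}
    (*-congʳ {Π (parts S 72)} {gen S} {genLe S (M ℕ.* 72)}
      -- For n < M the bound 72 M on the parts exceeds n and does not affect the count.
      (λ n n<M → ≡.cong +_ (≡.sym (pLe-stable S (ℕₚ.≤⇒≤′ (ℕₚ.≤-trans (ℕₚ.<⇒≤ n<M) (ℕₚ.m≤m*n M 72)))))))
    (Π-parts-inverse S periodic (genLe S) (genLe-0 S) (genLe-recurrence S)
      (λ m e n _ → ≡.cong +_ (pLe-nonpart S m n e)))

partition-identity : ∀ a b C S T xs ys →
  let U = pmMod 72 xs; V = pmMod 72 ys in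
  {adC : True (admissible? C)} {adS : True (admissible? S)} {adT : True (admissible? T)} →
  length C ≡ length S → length C ≡ length T →
  sort (concatMap residues± C ++ concatMap residues± S) ≡ sort (parts U 72 ++ concatMap doubled± S) →
  sort (concatMap residues± C ++ concatMap residues± T) ≡ sort (parts V 72 ++ concatMap doubled± T) →
  (∀ M → let open GeneratingFunction M; open CommutativeRing (truncated M)
             open RawSemiringDefinitions (Semiring.rawSemiring semiring) using (_^_)
         in Θ 1# S ≈ X ^ a * Θ 1# T + X ^ b * Θ (- 1#) C) →
  ∀ n → a ℕ.+ n ≢ b → p U (a ℕ.+ n) ≡ p V n
partition-identity a b C S T xs ys {adC} {adS} {adT} lenS lenT eqU eqV eq n ≢b = ℤₚ.+-injective (begin
  + p U (a ℕ.+ n)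
    ≡⟨ quotient-identity {gen U} {gen V} {parts U 72} {parts V 72} a b
         (toWitness adC) (toWitness adS) (toWitness adT) lenS lenT
         (gen-inverse U (pmMod-periodic xs)) (gen-inverse V (pmMod-periodic ys)) eqU eqV (eq M) (a ℕ.+ n) ℕₚ.≤-refl ⟩
  ((X ^ a) ⊛ gen V) (a ℕ.+ n) ℤ.+ (X ^ b) (a ℕ.+ n)
    ≡⟨ ≡.cong₂ ℤ._+_
         (≡.trans (⊛-cong-≤ (a ℕ.+ n) {g = gen V} (λ k _ → X^≡ a k) (λ _ _ → ≡.refl)) (X^-⊛-+ a (gen V) n))
         (≡.trans (X^≡ b (a ℕ.+ n)) (X^-coefficient b (a ℕ.+ n) ≢b)) ⟩
  + p V n ℤ.+ 0ℤ
    ≡⟨ ℤₚ.+-identityʳ _ ⟩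
  + p V n ∎)
  where
  open ≡.≡-Reasoning
  -- The least M for which the coefficient of q^(a+n) survives truncation.
  M = suc (a ℕ.+ n)
  U = pmMod 72 xs
  V = pmMod 72 ys
  open GeneratingFunction M
  open RawSemiringDefinitions (Semiring.rawSemiring (CommutativeRing.semiring (truncated M))) using (_^_)

open import Data.Nat using (_+_)

theorem18p1 : ((n : ℕ) → p (pmMod 72 (1 ∷ 3 ∷ 5 ∷ 7 ∷ 8 ∷ 26 ∷ 28 ∷ 29 ∷ 30 ∷ 31 ∷ 33 ∷ 35 ∷ [])) (suc n)
    ≡ p (pmMod 72 (1 ∷ 2 ∷ 5 ∷ 7 ∷ 13 ∷ 23 ∷ 28 ∷ 29 ∷ 31 ∷ 32 ∷ 34 ∷ 35 ∷ [])) n)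
    × ((n : ℕ) → n ≢ 6 → p (pmMod 72 (1 ∷ 4 ∷ 5 ∷ 6 ∷ 11 ∷ 14 ∷ 15 ∷ 21 ∷ 25 ∷ 31 ∷ 32 ∷ 35 ∷ [])) n
    ≡ p (pmMod 72 (1 ∷ 4 ∷ 5 ∷ 7 ∷ 10 ∷ 11 ∷ 16 ∷ 25 ∷ 26 ∷ 29 ∷ 31 ∷ 35 ∷ [])) n)
    × ((n : ℕ) → p (pmMod 72 (1 ∷ 7 ∷ 8 ∷ 13 ∷ 14 ∷ 17 ∷ 19 ∷ 20 ∷ 22 ∷ 23 ∷ 29 ∷ 35 ∷ [])) (suc n)
    ≡ p (pmMod 72 (1 ∷ 6 ∷ 7 ∷ 13 ∷ 15 ∷ 16 ∷ 20 ∷ 21 ∷ 23 ∷ 29 ∷ 34 ∷ 35 ∷ [])) n)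
    × ((n : ℕ) → n ≢ 1 → p (pmMod 72 (2 ∷ 3 ∷ 5 ∷ 11 ∷ 16 ∷ 17 ∷ 19 ∷ 20 ∷ 25 ∷ 30 ∷ 31 ∷ 33 ∷ [])) n
    ≡ p (pmMod 72 (1 ∷ 5 ∷ 8 ∷ 11 ∷ 14 ∷ 17 ∷ 19 ∷ 20 ∷ 22 ∷ 25 ∷ 31 ∷ 35 ∷ [])) n)
    × ((n : ℕ) → p (pmMod 72 (4 ∷ 7 ∷ 10 ∷ 11 ∷ 13 ∷ 16 ∷ 17 ∷ 19 ∷ 23 ∷ 25 ∷ 26 ∷ 29 ∷ [])) (n + 4)
    ≡ p (pmMod 72 (3 ∷ 4 ∷ 7 ∷ 13 ∷ 17 ∷ 19 ∷ 22 ∷ 23 ∷ 29 ∷ 30 ∷ 32 ∷ 33 ∷ [])) n)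
    × ((n : ℕ) → p (pmMod 72 (6 ∷ 8 ∷ 10 ∷ 11 ∷ 13 ∷ 15 ∷ 17 ∷ 19 ∷ 21 ∷ 23 ∷ 25 ∷ 28 ∷ [])) (n + 6)
    ≡ p (pmMod 72 (2 ∷ 5 ∷ 11 ∷ 13 ∷ 17 ∷ 19 ∷ 23 ∷ 25 ∷ 28 ∷ 31 ∷ 32 ∷ 34 ∷ [])) n)
theorem18p1 =
  -- In parts (i), (iii), (v) and (vi) the monomial is q^0, and a > 0 keeps a + n away from it.
  (λ n → partition-identity 1 0 (1 ∷ 7 ∷ 8 ∷ 10 ∷ []) (3 ∷ 5 ∷ 6 ∷ 12 ∷ []) (2 ∷ 4 ∷ 5 ∷ 13 ∷ [])
    (1 ∷ 3 ∷ 5 ∷ 7 ∷ 8 ∷ 26 ∷ 28 ∷ 29 ∷ 30 ∷ 31 ∷ 33 ∷ 35 ∷ [])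
    (1 ∷ 2 ∷ 5 ∷ 7 ∷ 13 ∷ 23 ∷ 28 ∷ 29 ∷ 31 ∷ 32 ∷ 34 ∷ 35 ∷ [])
    ≡.refl ≡.refl ≡.refl ≡.refl GeneratingFunction.three-term₁ n (λ ())) ,
  (λ n n≢6 → partition-identity 0 6 (1 ∷ 5 ∷ 4 ∷ 14 ∷ []) (11 ∷ 15 ∷ 6 ∷ 12 ∷ []) (7 ∷ 11 ∷ 10 ∷ 16 ∷ [])
    (1 ∷ 4 ∷ 5 ∷ 6 ∷ 11 ∷ 14 ∷ 15 ∷ 21 ∷ 25 ∷ 31 ∷ 32 ∷ 35 ∷ [])
    (1 ∷ 4 ∷ 5 ∷ 7 ∷ 10 ∷ 11 ∷ 16 ∷ 25 ∷ 26 ∷ 29 ∷ 31 ∷ 35 ∷ [])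
    ≡.refl ≡.refl ≡.refl ≡.refl GeneratingFunction.three-term₂ n n≢6) ,
  (λ n → partition-identity 1 0 (7 ∷ 13 ∷ 2 ∷ 16 ∷ []) (1 ∷ 17 ∷ 8 ∷ 14 ∷ []) (1 ∷ 15 ∷ 6 ∷ 12 ∷ [])
    (1 ∷ 7 ∷ 8 ∷ 13 ∷ 14 ∷ 17 ∷ 19 ∷ 20 ∷ 22 ∷ 23 ∷ 29 ∷ 35 ∷ [])
    (1 ∷ 6 ∷ 7 ∷ 13 ∷ 15 ∷ 16 ∷ 20 ∷ 21 ∷ 23 ∷ 29 ∷ 34 ∷ 35 ∷ [])
    ≡.refl ≡.refl ≡.refl ≡.refl GeneratingFunction.three-term₃ n (λ ())) ,
  -- Here the set containing 1 takes the first place: its generating function is the larger one, by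
  -- the monomial q.
  (λ n n≢1 → ≡.sym (partition-identity 0 1 (5 ∷ 11 ∷ 2 ∷ 16 ∷ []) (8 ∷ 14 ∷ 1 ∷ 17 ∷ []) (6 ∷ 12 ∷ 3 ∷ 17 ∷ [])
    (1 ∷ 5 ∷ 8 ∷ 11 ∷ 14 ∷ 17 ∷ 19 ∷ 20 ∷ 22 ∷ 25 ∷ 31 ∷ 35 ∷ [])
    (2 ∷ 3 ∷ 5 ∷ 11 ∷ 16 ∷ 17 ∷ 19 ∷ 20 ∷ 25 ∷ 30 ∷ 31 ∷ 33 ∷ [])
    ≡.refl ≡.refl ≡.refl ≡.refl GeneratingFunction.three-term₄ n n≢1)) ,
  (λ n → ≡.trans (≡.cong (p _) (ℕₚ.+-comm n 4))
    (partition-identity 4 0 (13 ∷ 17 ∷ 4 ∷ 14 ∷ []) (7 ∷ 11 ∷ 10 ∷ 16 ∷ []) (3 ∷ 7 ∷ 6 ∷ 12 ∷ [])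
    (4 ∷ 7 ∷ 10 ∷ 11 ∷ 13 ∷ 16 ∷ 17 ∷ 19 ∷ 23 ∷ 25 ∷ 26 ∷ 29 ∷ [])
    (3 ∷ 4 ∷ 7 ∷ 13 ∷ 17 ∷ 19 ∷ 22 ∷ 23 ∷ 29 ∷ 30 ∷ 32 ∷ 33 ∷ [])
    ≡.refl ≡.refl ≡.refl ≡.refl GeneratingFunction.three-term₅ n (λ ()))) ,
  (λ n → ≡.trans (≡.cong (p _) (ℕₚ.+-comm n 6))
    (partition-identity 6 0 (8 ∷ 10 ∷ 11 ∷ 17 ∷ []) (13 ∷ 15 ∷ 6 ∷ 12 ∷ []) (2 ∷ 4 ∷ 5 ∷ 13 ∷ [])
    (6 ∷ 8 ∷ 10 ∷ 11 ∷ 13 ∷ 15 ∷ 17 ∷ 19 ∷ 21 ∷ 23 ∷ 25 ∷ 28 ∷ [])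
    (2 ∷ 5 ∷ 11 ∷ 13 ∷ 17 ∷ 19 ∷ 23 ∷ 25 ∷ 28 ∷ 31 ∷ 32 ∷ 34 ∷ [])
    ≡.refl ≡.refl ≡.refl ≡.refl GeneratingFunction.three-term₆ n (λ ())))
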